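{- A finite simple graph is $\{P_5,\overline{P_5}\}$-free if and only if it is obtained from pentagons and split graphs by repeated substitutions, split unifications, and split unifications in the complement; that is, if and only if it belongs to the smallest class of graphs that contains all graphs isomorphic to $C_5$ and all split graphs and is closed under substitution (substituting a graph of the class for a vertex of a graph of the class), under taking the split unification of a composable pair of graphs of the class, and under taking a graph whose complement is the split unification of a composable pair $(G_1,G_2)$ with $\overline{G_1},\overline{G_2}$ in the class.
   Context: $P_5$ is the path on 5 vertices, $C_5$ (pentagon) the 5-cycle, $\overline{G}$ the complement of $G$. A graph is $\{P_5,\overline{P_5}\}$-free if it has no induced subgraph isomorphic to $P_5$ or $\overline{P_5}$. A graph is split if its vertex set can be partitioned into a clique and a stable set. Substitution: given vertex-disjoint graphs $G_0$ and $H$ and a vertex $x$ of $G_0$, the graph obtained by substituting $H$ for $x$ has vertex set $V(G_0\setminus x)\cup V(H)$, consists of the union of $G_0\setminus x$ and $H$, plus all edges between $V(H)$ and the neighbors of $x$ in $G_0$. For $S\subseteq V(G)$ and $v\notin S$: $v$ is complete to $S$ if adjacent to all of $S$, anticomplete if adjacent to none, mixed on $S$ otherwise; a set is complete (anticomplete) to a disjoint set if each of its vertices is. An anticomponent of $S$ is a subset of $S$ inducing a connected component of the complement of $G[S]$. Composable pair: let $A,B,C,L,T$ be pairwise disjoint sets with $A,C$ non-empty, and $a^*,c^*$ two distinct vertices not in $A\cup B\cup C\cup L\cup T$. $G_1$ is a graph on $A\cup B\cup L\cup T\cup\{c^*\}$ such that $L$ is a (possibly empty) clique, $T$ is a (possibly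 empty) stable set, $A$ is complete to $B$ and anticomplete to $T$, some vertex of $A$ is complete to $L$, and $c^*$ is complete to $B\cup L$ and anticomplete to $A\cup T$ (other adjacencies arbitrary). $G_2$ is a graph on $B\cup C\cup L\cup T\cup\{a^*\}$ such that $G_2[B\cup L\cup T]=G_1[B\cup L\cup T]$, $T$ is anticomplete to $C$, $L$ is complete to $B\cup C$, $a^*$ is complete to $B\cup L$ and anticomplete to $C\cup T$, some vertex of $C$ is complete to $B$, and no vertex of $C$ is mixed on any anticomponent of $B$ (other adjacencies arbitrary). Its split unification is the graph on $A\cup B\cup C\cup L\cup T$ whose restriction to $A\cup B\cup L\cup T$ is $G_1\setminus c^*$, whose restriction to $B\cup C\cup L\cup T$ is $G_2\setminus a^*$, and in which $A$ is anticomplete to $C$. -}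

module Defs where

open import Data.Bool using (Bool; true; false; not; _∨_; _∧_; if_then_else_; T)
open import Data.Bool.Properties using (∨-comm; T-irrelevant)
open import Data.Nat using (ℕ; suc; _≡ᵇ_)
open import Data.Fin using (Fin; zero; suc; toℕ)
import Data.Fin.Properties as FinP
open import Data.Product using (Σ; Σ-syntax; _×_; _,_)
open import Data.Sum using (_⊎_; inj₁; inj₂)
import Data.Sum.Properties as SumP
import Data.Product.Properties as ProdP
open import Data.Empty using (⊥-elim)
open import Relation.Nullary using (¬_; Dec; yes; no; does)
open import Relation.Nullary.Decidable using (map′)
open import Relation.Binary.Definitions using (DecidableEquality)
open import Relation.Binary.PropositionalEquality using (_≡_; _≢_; refl; sym; trans; cong)
open import Relation.Binary.Construct.Closure.ReflexiveTransitive using (Star)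
open import Function.Bundles using (_↔_; Inverse)
open import Function.Definitions using (Injective)

record GraphOn (V : Set) : Set where
  field
    _≟_        : DecidableEquality V
    adj        : V → V → Bool
    adj-sym    : ∀ u v → adj u v ≡ adj v u
    adj-irrefl : ∀ v → adj v v ≡ false

record Graph : Set₁ where
  constructor mkGraph
  field
    V   : Set
    str : GraphOn V
  open GraphOn str public

open Graph

Finite : Graph → Set
Finite G = Σ[ n ∈ ℕ ] (V G ↔ Fin n)

Iso : Graph → Graph → Set
Iso G H = Σ[ f ∈ (V G ↔ V H) ]
  (∀ u v → adj H (Inverse.to f u) (Inverse.to f v) ≡ adj G u v)

HasInduced : Graph → Graph → Set
HasInduced G H = Σ[ f ∈ (V H → V G) ]
  (Injective _≡_ _≡_ f × (∀ u v → adj G (f u) (f v) ≡ adj H u v))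

complement : Graph → Graph
complement G = mkGraph (V G) record
  { _≟_ = _≟_ G
  ; adj = adjᶜ
  ; adj-sym = symᶜ
  ; adj-irrefl = irrᶜ
  }
  where
  adjᶜ : V G → V G → Bool
  adjᶜ u v = if does (_≟_ G u v) then false else not (adj G u v)
  symᶜ : ∀ u v → adjᶜ u v ≡ adjᶜ v u
  symᶜ u v with _≟_ G u v | _≟_ G v u
  ... | yes _ | yes _ = refl
  ... | yes p | no q = ⊥-elim (q (sym p))
  ... | no p | yes q = ⊥-elim (p (sym q))
  ... | no _ | no _ = cong not (adj-sym G u v)
  irrᶜ : ∀ v → adjᶜ v v ≡ false
  irrᶜ v with _≟_ G v v
  ... | yes _ = refl
  ... | no p = ⊥-elim (p refl)

p5adj : Fin 5 → Fin 5 → Bool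
p5adj i j = (suc (toℕ i) ≡ᵇ toℕ j) ∨ (suc (toℕ j) ≡ᵇ toℕ i)

P5 : Graph
P5 = mkGraph (Fin 5) record
  { _≟_ = FinP._≟_
  ; adj = p5adj
  ; adj-sym = λ i j → ∨-comm (suc (toℕ i) ≡ᵇ toℕ j) (suc (toℕ j) ≡ᵇ toℕ i)
  ; adj-irrefl = irr
  }
  where
  irr : ∀ v → p5adj v v ≡ false
  irr zero = refl
  irr (suc zero) = refl
  irr (suc (suc zero)) = refl
  irr (suc (suc (suc zero))) = refl
  irr (suc (suc (suc (suc zero)))) = refl

next5 : Fin 5 → Fin 5
next5 zero = suc zero
next5 (suc zero) = suc (suc zero)
next5 (suc (suc zero)) = suc (suc (suc zero))
next5 (suc (suc (suc zero))) = suc (suc (suc (suc zero)))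
next5 (suc (suc (suc (suc zero)))) = zero

c5adj : Fin 5 → Fin 5 → Bool
c5adj i j = does (j FinP.≟ next5 i) ∨ does (i FinP.≟ next5 j)

C5 : Graph
C5 = mkGraph (Fin 5) record
  { _≟_ = FinP._≟_
  ; adj = c5adj
  ; adj-sym = λ i j → ∨-comm (does (j FinP.≟ next5 i)) (does (i FinP.≟ next5 j))
  ; adj-irrefl = irr
  }
  where
  irr : ∀ v → c5adj v v ≡ false
  irr zero = refl
  irr (suc zero) = refl
  irr (suc (suc zero)) = refl
  irr (suc (suc (suc zero))) = refl
  irr (suc (suc (suc (suc zero)))) = refl

P5coP5Free : Graph → Set
P5coP5Free G = ¬ HasInduced G P5 × ¬ HasInduced G (complement P5)

IsSplit : Graph → Set
IsSplit G = Σ[ p ∈ (V G → Bool) ]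
  ( (∀ u v → u ≢ v → p u ≡ true → p v ≡ true → adj G u v ≡ true)
  × (∀ u v → p u ≡ false → p v ≡ false → adj G u v ≡ false))

substitute : (G₀ : Graph) → V G₀ → Graph → Graph
substitute G₀ x H = mkGraph W record
  { _≟_ = SumP.≡-dec (ProdP.≡-dec (_≟_ G₀) λ p q → yes (T-irrelevant p q)) (_≟_ H)
  ; adj = adjS
  ; adj-sym = symS
  ; adj-irrefl = irrS
  }
  where
  W₀ : Set
  W₀ = Σ[ v ∈ V G₀ ] T (not (does (_≟_ G₀ v x)))
  W : Set
  W = W₀ ⊎ V H
  adjS : W → W → Bool
  adjS (inj₁ (u , _)) (inj₁ (v , _)) = adj G₀ u v
  adjS (inj₁ (u , _)) (inj₂ h) = adj G₀ u x
  adjS (inj₂ h) (inj₁ (u , _)) = adj G₀ u x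
  adjS (inj₂ h) (inj₂ h′) = adj H h h′
  symS : ∀ u v → adjS u v ≡ adjS v u
  symS (inj₁ (u , _)) (inj₁ (v , _)) = adj-sym G₀ u v
  symS (inj₁ _) (inj₂ _) = refl
  symS (inj₂ _) (inj₁ _) = refl
  symS (inj₂ h) (inj₂ h′) = adj-sym H h h′
  irrS : ∀ v → adjS v v ≡ false
  irrS (inj₁ (u , _)) = adj-irrefl G₀ u
  irrS (inj₂ h) = adj-irrefl H h

-- Composable pairs and split unification.
-- The pairwise disjoint sets A, B, C, L, T and the extra vertices
-- a*, c* are modelled by tagged vertex types.

data V₁ (A B L T : Set) : Set where
  a₁ : A → V₁ A B L T
  b₁ : B → V₁ A B L T
  l₁ : L → V₁ A B L T
  t₁ : T → V₁ A B L T
  c* : V₁ A B L T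

data V₂ (B C L T : Set) : Set where
  b₂ : B → V₂ B C L T
  c₂ : C → V₂ B C L T
  l₂ : L → V₂ B C L T
  t₂ : T → V₂ B C L T
  a* : V₂ B C L T

data BLT (B L T : Set) : Set where
  b : B → BLT B L T
  l : L → BLT B L T
  t : T → BLT B L T

ι₁ : ∀ {A B L T} → BLT B L T → V₁ A B L T
ι₁ (b y) = b₁ y
ι₁ (l y) = l₁ y
ι₁ (t y) = t₁ y

ι₂ : ∀ {B C L T} → BLT B L T → V₂ B C L T
ι₂ (b y) = b₂ y
ι₂ (l y) = l₂ y
ι₂ (t y) = t₂ y

MixedOn : ∀ {V} → GraphOn V → V → (V → Set) → Set
MixedOn G v S = Σ[ u ∈ _ ] Σ[ w ∈ _ ]
  (S u × S w × GraphOn.adj G v u ≡ true × GraphOn.adj G v w ≡ false)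

module _ {A B C L T : Set} where

  record Composable (G₁ : GraphOn (V₁ A B L T)) (G₂ : GraphOn (V₂ B C L T)) : Set where
    private
      adj₁ = GraphOn.adj G₁
      adj₂ = GraphOn.adj G₂
    field
      A-nonempty : A
      C-nonempty : C
      L-clique      : ∀ x y → x ≢ y → adj₁ (l₁ x) (l₁ y) ≡ true
      T-stable      : ∀ x y → adj₁ (t₁ x) (t₁ y) ≡ false
      A-complete-B  : ∀ x y → adj₁ (a₁ x) (b₁ y) ≡ true
      A-anti-T      : ∀ x y → adj₁ (a₁ x) (t₁ y) ≡ false
      A-to-L        : Σ[ x ∈ A ] (∀ y → adj₁ (a₁ x) (l₁ y) ≡ true)
      c*-complete-B : ∀ y → adj₁ c* (b₁ y) ≡ true
      c*-complete-L : ∀ y → adj₁ c* (l₁ y) ≡ true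
      c*-anti-A     : ∀ y → adj₁ c* (a₁ y) ≡ false
      c*-anti-T     : ∀ y → adj₁ c* (t₁ y) ≡ false
      same-BLT      : ∀ u v → adj₂ (ι₂ u) (ι₂ v) ≡ adj₁ (ι₁ u) (ι₁ v)
      T-anti-C      : ∀ x y → adj₂ (t₂ x) (c₂ y) ≡ false
      L-complete-B  : ∀ x y → adj₂ (l₂ x) (b₂ y) ≡ true
      L-complete-C  : ∀ x y → adj₂ (l₂ x) (c₂ y) ≡ true
      a*-complete-B : ∀ y → adj₂ a* (b₂ y) ≡ true
      a*-complete-L : ∀ y → adj₂ a* (l₂ y) ≡ true
      a*-anti-C     : ∀ y → adj₂ a* (c₂ y) ≡ false
      a*-anti-T     : ∀ y → adj₂ a* (t₂ y) ≡ false
      C-to-B        : Σ[ z ∈ C ] (∀ y → adj₂ (c₂ z) (b₂ y) ≡ true)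
      -- no vertex of C is mixed on any anticomponent of B; the
      -- anticomponent of y ∈ B is the set of y′ ∈ B reachable from y by
      -- steps between non-adjacent vertices of B
      C-not-mixed   : ∀ z y → ¬ MixedOn G₂ (c₂ z)
                        (λ w → Σ[ y′ ∈ B ] (w ≡ b₂ y′ ×
                           Star (λ u v → adj₂ (b₂ u) (b₂ v) ≡ false) y y′))

  data Vᵤ : Set where
    aᵤ : A → Vᵤ
    bᵤ : B → Vᵤ
    cᵤ : C → Vᵤ
    lᵤ : L → Vᵤ
    tᵤ : T → Vᵤ

  module SU (G₁ : GraphOn (V₁ A B L T)) (G₂ : GraphOn (V₂ B C L T)) where
    private
      adj₁ = GraphOn.adj G₁
      adj₂ = GraphOn.adj G₂
      s₁ = GraphOn.adj-sym G₁
      s₂ = GraphOn.adj-sym G₂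

    adjU : Vᵤ → Vᵤ → Bool
    adjU (aᵤ x) (aᵤ y) = adj₁ (a₁ x) (a₁ y)
    adjU (aᵤ x) (bᵤ y) = adj₁ (a₁ x) (b₁ y)
    adjU (aᵤ x) (cᵤ y) = false
    adjU (aᵤ x) (lᵤ y) = adj₁ (a₁ x) (l₁ y)
    adjU (aᵤ x) (tᵤ y) = adj₁ (a₁ x) (t₁ y)
    adjU (bᵤ x) (aᵤ y) = adj₁ (b₁ x) (a₁ y)
    adjU (bᵤ x) (bᵤ y) = adj₁ (b₁ x) (b₁ y)
    adjU (bᵤ x) (cᵤ y) = adj₂ (b₂ x) (c₂ y)
    adjU (bᵤ x) (lᵤ y) = adj₁ (b₁ x) (l₁ y)
    adjU (bᵤ x) (tᵤ y) = adj₁ (b₁ x) (t₁ y)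
    adjU (cᵤ x) (aᵤ y) = false
    adjU (cᵤ x) (bᵤ y) = adj₂ (c₂ x) (b₂ y)
    adjU (cᵤ x) (cᵤ y) = adj₂ (c₂ x) (c₂ y)
    adjU (cᵤ x) (lᵤ y) = adj₂ (c₂ x) (l₂ y)
    adjU (cᵤ x) (tᵤ y) = adj₂ (c₂ x) (t₂ y)
    adjU (lᵤ x) (aᵤ y) = adj₁ (l₁ x) (a₁ y)
    adjU (lᵤ x) (bᵤ y) = adj₁ (l₁ x) (b₁ y)
    adjU (lᵤ x) (cᵤ y) = adj₂ (l₂ x) (c₂ y)
    adjU (lᵤ x) (lᵤ y) = adj₁ (l₁ x) (l₁ y)
    adjU (lᵤ x) (tᵤ y) = adj₁ (l₁ x) (t₁ y)
    adjU (tᵤ x) (aᵤ y) = adj₁ (t₁ x) (a₁ y)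
    adjU (tᵤ x) (bᵤ y) = adj₁ (t₁ x) (b₁ y)
    adjU (tᵤ x) (cᵤ y) = adj₂ (t₂ x) (c₂ y)
    adjU (tᵤ x) (lᵤ y) = adj₁ (t₁ x) (l₁ y)
    adjU (tᵤ x) (tᵤ y) = adj₁ (t₁ x) (t₁ y)

    symU : ∀ u v → adjU u v ≡ adjU v u
    symU (aᵤ x) (aᵤ y) = s₁ _ _
    symU (aᵤ x) (bᵤ y) = s₁ _ _
    symU (aᵤ x) (cᵤ y) = refl
    symU (aᵤ x) (lᵤ y) = s₁ _ _
    symU (aᵤ x) (tᵤ y) = s₁ _ _
    symU (bᵤ x) (aᵤ y) = s₁ _ _
    symU (bᵤ x) (bᵤ y) = s₁ _ _
    symU (bᵤ x) (cᵤ y) = s₂ _ _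
    symU (bᵤ x) (lᵤ y) = s₁ _ _
    symU (bᵤ x) (tᵤ y) = s₁ _ _
    symU (cᵤ x) (aᵤ y) = refl
    symU (cᵤ x) (bᵤ y) = s₂ _ _
    symU (cᵤ x) (cᵤ y) = s₂ _ _
    symU (cᵤ x) (lᵤ y) = s₂ _ _
    symU (cᵤ x) (tᵤ y) = s₂ _ _
    symU (lᵤ x) (aᵤ y) = s₁ _ _
    symU (lᵤ x) (bᵤ y) = s₁ _ _
    symU (lᵤ x) (cᵤ y) = s₂ _ _
    symU (lᵤ x) (lᵤ y) = s₁ _ _
    symU (lᵤ x) (tᵤ y) = s₁ _ _
    symU (tᵤ x) (aᵤ y) = s₁ _ _
    symU (tᵤ x) (bᵤ y) = s₁ _ _
    symU (tᵤ x) (cᵤ y) = s₂ _ _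
    symU (tᵤ x) (lᵤ y) = s₁ _ _
    symU (tᵤ x) (tᵤ y) = s₁ _ _

    irrU : ∀ v → adjU v v ≡ false
    irrU (aᵤ x) = GraphOn.adj-irrefl G₁ _
    irrU (bᵤ x) = GraphOn.adj-irrefl G₁ _
    irrU (cᵤ x) = GraphOn.adj-irrefl G₂ _
    irrU (lᵤ x) = GraphOn.adj-irrefl G₁ _
    irrU (tᵤ x) = GraphOn.adj-irrefl G₁ _

    private
      _≟₁_ = GraphOn._≟_ G₁
      _≟₂_ = GraphOn._≟_ G₂

    _≟U_ : DecidableEquality Vᵤ
    aᵤ x ≟U aᵤ y = map′ (λ { refl → refl }) (λ { refl → refl }) (a₁ x ≟₁ a₁ y)
    bᵤ x ≟U bᵤ y = map′ (λ { refl → refl }) (λ { refl → refl }) (b₁ x ≟₁ b₁ y)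
    cᵤ x ≟U cᵤ y = map′ (λ { refl → refl }) (λ { refl → refl }) (c₂ x ≟₂ c₂ y)
    lᵤ x ≟U lᵤ y = map′ (λ { refl → refl }) (λ { refl → refl }) (l₁ x ≟₁ l₁ y)
    tᵤ x ≟U tᵤ y = map′ (λ { refl → refl }) (λ { refl → refl }) (t₁ x ≟₁ t₁ y)
    aᵤ _ ≟U bᵤ _ = no λ ()
    aᵤ _ ≟U cᵤ _ = no λ ()
    aᵤ _ ≟U lᵤ _ = no λ ()
    aᵤ _ ≟U tᵤ _ = no λ ()
    bᵤ _ ≟U aᵤ _ = no λ ()
    bᵤ _ ≟U cᵤ _ = no λ ()
    bᵤ _ ≟U lᵤ _ = no λ ()
    bᵤ _ ≟U tᵤ _ = no λ ()
    cᵤ _ ≟U aᵤ _ = no λ ()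
    cᵤ _ ≟U bᵤ _ = no λ ()
    cᵤ _ ≟U lᵤ _ = no λ ()
    cᵤ _ ≟U tᵤ _ = no λ ()
    lᵤ _ ≟U aᵤ _ = no λ ()
    lᵤ _ ≟U bᵤ _ = no λ ()
    lᵤ _ ≟U cᵤ _ = no λ ()
    lᵤ _ ≟U tᵤ _ = no λ ()
    tᵤ _ ≟U aᵤ _ = no λ ()
    tᵤ _ ≟U bᵤ _ = no λ ()
    tᵤ _ ≟U cᵤ _ = no λ ()
    tᵤ _ ≟U lᵤ _ = no λ ()

  -- The split unification of a composable pair (G₁, G₂): on A∪B∪L∪T it
  -- agrees with G₁ ∖ c*, on B∪C∪L∪T with G₂ ∖ a* (on B∪L∪T the two agree
  -- by `same-BLT`), and A is anticomplete to C.
  splitUnification : (G₁ : GraphOn (V₁ A B L T)) (G₂ : GraphOn (V₂ B C L T)) →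
                     Composable G₁ G₂ → Graph
  splitUnification G₁ G₂ _ = mkGraph Vᵤ record
    { _≟_ = SU._≟U_ G₁ G₂
    ; adj = SU.adjU G₁ G₂
    ; adj-sym = SU.symU G₁ G₂
    ; adj-irrefl = SU.irrU G₁ G₂
    }

-- The class generated from pentagons and split graphs by substitution,
-- split unification and split unification in the complement
-- (smallest such class = inductive predicate; classes of graphs are
-- closed under isomorphism).

data InClass : Graph → Set₁ where
  pentagon : ∀ G → Iso C5 G → InClass G
  split    : ∀ G → Finite G → IsSplit G → InClass G
  subst    : ∀ G₀ (x : V G₀) H → InClass G₀ → InClass H →
             InClass (substitute G₀ x H)
  unif     : ∀ {A B C L T : Set} (G₁ : GraphOn (V₁ A B L T)) (G₂ : GraphOn (V₂ B C L T))
             (cp : Composable G₁ G₂) →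
             InClass (mkGraph _ G₁) → InClass (mkGraph _ G₂) →
             InClass (splitUnification G₁ G₂ cp)
  counif   : ∀ {A B C L T : Set} (G₁ : GraphOn (V₁ A B L T)) (G₂ : GraphOn (V₂ B C L T))
             (cp : Composable G₁ G₂) →
             InClass (complement (mkGraph _ G₁)) → InClass (complement (mkGraph _ G₂)) →
             ∀ G → Iso (complement G) (splitUnification G₁ G₂ cp) → InClass G
  iso      : ∀ G H → Iso G H → InClass G → InClass H

{-# OPTIONS --safe #-}
-- Class ⇒ free: P₅ and its complement are not split, not contained in C₅ and have no homogeneous
-- set, so only unifications matter.  Colour the five vertices of a copy by the part A, B, C, L, T
-- they lie in: a finite check shows that, if the colouring respects the adjacencies imposed on the
-- parts, at most one vertex lies in A and is complete to those in L (then a* can replace it and the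
-- copy lives in G₂), or at most one lies in C and is complete to those in B (then c* can replace it).
--
-- Free ⇒ class, by induction on the number of vertices.  A free graph containing a C₅ is a C₅ or
-- has a homogeneous set (Fouquet), i.e. is a substitution.  A graph without C₅, 2K₂ and C₄ is split
-- (Földes–Hammer).  Otherwise, up to complement, some connected set with at least two vertices is
-- anticomplete to an edge.  Let C be a maximal such set, let A be the set of non-isolated vertices
-- and T that of isolated vertices of the graph induced by the vertices anticomplete to C, let B be
-- the set of those neighbours of C that are complete to A, and L that of the other neighbours.  All
-- requirements of a split unification then hold, with pieces smaller than G since |A|, |C| ≥ 2,
-- except possibly that L is a clique.  If it is not, the same construction in the complement,
-- started from a non-trivial anticomponent of L, gives a set L that is a clique of the complement.
module Submission where

open import Defs
open import Axiom.UniquenessOfIdentityProofs.WithK using (uip)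
import Data.Bool as Bool
open import Data.Bool using (Bool; true; false; not; _∧_; if_then_else_)
import Data.Bool.Properties as BoolP
open import Data.Empty using (⊥; ⊥-elim)
open import Data.Fin using (Fin; zero; suc)
open import Data.Fin.Patterns using (0F; 1F; 2F; 3F; 4F)
open import Data.Fin.Properties as FinP using (all?; any?)
open import Data.List as List using (List; []; _∷_; length; mapMaybe; filter)
open import Data.List.Membership.Propositional using (_∈_; find; lose)
import Data.List.Membership.Propositional.Properties as ∈P
import Data.List.Properties as ListP
open import Data.List.Relation.Unary.All as All using (All; []; _∷_)
import Data.List.Relation.Unary.All.Properties as AllP
open import Data.List.Relation.Unary.AllPairs using ([]; _∷_)
open import Data.List.Relation.Unary.Any as Any using (here; there)
open import Data.List.Relation.Unary.Any.Properties using (lookup-index)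
open import Data.List.Relation.Unary.Unique.DecPropositional.Properties using (deduplicate-!)
open import Data.List.Relation.Unary.Unique.Propositional using (Unique)
open import Data.Maybe using (Maybe; just; nothing)
import Data.Maybe.Properties as MaybeP
open import Data.Nat using (ℕ; suc; _≤_; _<_; z≤n; s≤s)
import Data.Nat.Properties as ℕP
open import Data.Product using (Σ; ∃; _×_; _,_; proj₁; proj₂)
open import Data.Sum using (_⊎_; inj₁; inj₂; [_,_]′)
open import Data.Vec using (Vec; []; _∷_; lookup; tabulate)
open import Data.Vec.Properties using (lookup∘tabulate)
open import Function using (_∘_; Inverse)
open import Function.Bundles using (_⇔_; _↔_; mk⇔; mk↔ₛ′)
open import Function.Properties.Inverse using (↔-sym; ↔-refl)
open import Relation.Binary.Construct.Closure.ReflexiveTransitive using (Star; ε; _◅_)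
open import Relation.Binary.PropositionalEquality hiding (subst)
open import Relation.Nullary using (¬_; Dec; yes; no; does)
open import Relation.Nullary.Decidable using (_×-dec_; _⊎-dec_; _→-dec_; ¬?; from-yes; map′)

open Graph

-- Graphs of the class are free

Pattern : Set
Pattern = Fin 5 → Fin 5 → Bool

-- Quantifying over the five values separately makes the property decidable by exhaustion; `colour`
-- below recovers an arbitrary colouring through `tabulate`.
∀Colouring : (k : ℕ) → ((Fin 5 → Fin k) → Set) → Set
∀Colouring k P = (x₀ x₁ x₂ x₃ x₄ : Fin k) → P (lookup (x₀ ∷ x₁ ∷ x₂ ∷ x₃ ∷ x₄ ∷ []))

∀Colouring? : ∀ {k P} → (∀ c → Dec (P c)) → Dec (∀Colouring k P)
∀Colouring? P? =
  all? λ x₀ → all? λ x₁ → all? λ x₂ → all? λ x₃ → all? λ x₄ →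
  P? (lookup (x₀ ∷ x₁ ∷ x₂ ∷ x₃ ∷ x₄ ∷ []))

pattern 𝐚 = 0F
pattern 𝐛 = 1F
pattern 𝐜 = 2F
pattern 𝐥 = 3F
pattern 𝐭 = 4F

data Kind : Set where
  complete anticomplete arbitrary : Kind

-- Each constrained pair of parts is listed in one order only; `Violation` ranges over ordered
-- pairs, so the reversed entries may fall under `arbitrary`.
kind : Fin 5 → Fin 5 → Kind
kind 𝐥 𝐥 = complete
kind 𝐚 𝐛 = complete
kind 𝐥 𝐛 = complete
kind 𝐥 𝐜 = complete
kind 𝐭 𝐭 = anticomplete
kind 𝐚 𝐭 = anticomplete
kind 𝐚 𝐜 = anticomplete
kind 𝐭 𝐜 = anticomplete
kind _ _ = arbitrary

Violates : Kind → Bool → Set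
Violates complete e = e ≡ false
Violates anticomplete e = e ≡ true
Violates arbitrary e = ⊥

violates? : ∀ k e → Dec (Violates k e)
violates? complete e = e BoolP.≟ false
violates? anticomplete e = e BoolP.≟ true
violates? arbitrary e = no λ ()

-- Injectivity will follow from the adjacencies, as the patterns in question have no two vertices
-- with the same neighbourhood.
InducedMap : Graph → Graph → Set
InducedMap G H = Σ (V H → V G) λ f → ∀ u v → adj G (f u) (f v) ≡ adj H u v

module _ (q : Pattern) where

  -- If no vertex has colour x, any i will do.
  Lone : (x y : Fin 5) → (Fin 5 → Fin 5) → Set
  Lone x y c = ∃ λ i → ∀ j →
    (c j ≡ x → j ≡ i) × (c i ≡ x → c j ≡ y → q i j ≡ true)

  -- A one-step instance of being mixed on an anticomponent of B, which is all that a five-vertex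
  -- copy has to exhibit.
  MixedPair : (Fin 5 → Fin 5) → Set
  MixedPair c = ∃ λ i → c i ≡ 𝐛 × ∃ λ j → c j ≡ 𝐛 × q i j ≡ false ×
    ∃ λ k → c k ≡ 𝐜 × q k i ≡ true × q k j ≡ false

  Violation : (Fin 5 → Fin 5) → Set
  Violation c = ∃ λ i → ∃ λ j → i ≢ j × Violates (kind (c i) (c j)) (q i j)

  UnifOutcome : (Fin 5 → Fin 5) → Set
  UnifOutcome c = Violation c ⊎ Lone 𝐚 𝐥 c ⊎ Lone 𝐜 𝐛 c ⊎ MixedPair c

  lone? : ∀ x y c → Dec (Lone x y c)
  lone? x y c = any? λ i → all? λ j →
    (c j FinP.≟ x →-dec j FinP.≟ i) ×-dec
    (c i FinP.≟ x →-dec c j FinP.≟ y →-dec q i j BoolP.≟ true)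

  mixedPair? : ∀ c → Dec (MixedPair c)
  mixedPair? c = any? λ i → c i FinP.≟ 𝐛 ×-dec any? λ j → c j FinP.≟ 𝐛 ×-dec
    q i j BoolP.≟ false ×-dec
    any? λ k → c k FinP.≟ 𝐜 ×-dec q k i BoolP.≟ true ×-dec q k j BoolP.≟ false

  violation? : ∀ c → Dec (Violation c)
  violation? c = any? λ i → any? λ j →
    ¬? (i FinP.≟ j) ×-dec violates? (kind (c i) (c j)) (q i j)

  unifOutcome? : ∀ c → Dec (UnifOutcome c)
  unifOutcome? c = violation? c ⊎-dec lone? 𝐚 𝐥 c ⊎-dec lone? 𝐜 𝐛 c ⊎-dec mixedPair? c

  SplitOutcome : (Fin 5 → Fin 2) → Set
  SplitOutcome c = ∃ λ i → ∃ λ j → i ≢ j ×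
    (c i ≡ 1F × c j ≡ 1F × q i j ≡ false ⊎ c i ≡ 0F × c j ≡ 0F × q i j ≡ true)

  splitOutcome? : ∀ c → Dec (SplitOutcome c)
  splitOutcome? c = any? λ i → any? λ j → ¬? (i FinP.≟ j) ×-dec
    ((c i FinP.≟ 1F ×-dec c j FinP.≟ 1F ×-dec q i j BoolP.≟ false) ⊎-dec
     (c i FinP.≟ 0F ×-dec c j FinP.≟ 0F ×-dec q i j BoolP.≟ true))

  -- Colour 1 marks the substituted graph, colour 0 the rest. Either the copy lies in the
  -- substituted graph, or it meets it at most once, or one of its outer vertices is mixed on it.
  SubstOutcome : (Fin 5 → Fin 2) → Set
  SubstOutcome c = (∀ i → c i ≡ 1F) ⊎ (∃ λ i → ∀ j → c j ≡ 1F → j ≡ i) ⊎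
    (∃ λ k → c k ≡ 0F × ∃ λ i → c i ≡ 1F × q k i ≡ true × ∃ λ j → c j ≡ 1F × q k j ≡ false)

  substOutcome? : ∀ c → Dec (SubstOutcome c)
  substOutcome? c = (all? λ i → c i FinP.≟ 1F) ⊎-dec
    (any? λ i → all? λ j → c j FinP.≟ 1F →-dec j FinP.≟ i) ⊎-dec
    (any? λ k → c k FinP.≟ 0F ×-dec any? λ i → c i FinP.≟ 1F ×-dec q k i BoolP.≟ true ×-dec
      any? λ j → c j FinP.≟ 1F ×-dec q k j BoolP.≟ false)

  -- The colours are read as vertices of `C5`, so a colouring is a candidate embedding and the pair
  -- found refutes it.
  CycleOutcome : (Fin 5 → Fin 5) → Set
  CycleOutcome c = ∃ λ i → ∃ λ j → q i j ≢ c5adj (c i) (c j)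

  cycleOutcome? : ∀ c → Dec (CycleOutcome c)
  cycleOutcome? c = any? λ i → any? λ j → ¬? (q i j BoolP.≟ c5adj (c i) (c j))

  TwinFree : Set
  TwinFree = ∀ i j → (∀ k → q i k ≡ q j k) → i ≡ j

  twinFree? : Dec TwinFree
  twinFree? = all? λ i → all? λ j → (all? λ k → q i k BoolP.≟ q j k) →-dec i FinP.≟ j

  -- What the preservation proofs use about `P5` and `coP5`, collected so that each proof is carried
  -- out once for both.
  record Obstruction : Set where
    field
      twin-free     : TwinFree
      split-outcome : ∀Colouring 2 SplitOutcome
      subst-outcome : ∀Colouring 2 SubstOutcome
      cycle-outcome : ∀Colouring 5 CycleOutcome
      unif-outcome  : ∀Colouring 5 UnifOutcome

coP5 : Graph
coP5 = complement P5

-- Proved by evaluation: the decision procedures run through all 2⁵ or 5⁵ colourings.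
p5-obstruction : Obstruction (adj P5)
p5-obstruction = record
  { twin-free     = from-yes (twinFree? (adj P5))
  ; split-outcome = from-yes (∀Colouring? (splitOutcome? (adj P5)))
  ; subst-outcome = from-yes (∀Colouring? (substOutcome? (adj P5)))
  ; cycle-outcome = from-yes (∀Colouring? (cycleOutcome? (adj P5)))
  ; unif-outcome  = from-yes (∀Colouring? (unifOutcome? (adj P5)))
  }

coP5-obstruction : Obstruction (adj coP5)
coP5-obstruction = record
  { twin-free     = from-yes (twinFree? (adj coP5))
  ; split-outcome = from-yes (∀Colouring? (splitOutcome? (adj coP5)))
  ; subst-outcome = from-yes (∀Colouring? (substOutcome? (adj coP5)))
  ; cycle-outcome = from-yes (∀Colouring? (cycleOutcome? (adj coP5)))
  ; unif-outcome  = from-yes (∀Colouring? (unifOutcome? (adj coP5)))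
  }

true≢false : true ≢ false
true≢false ()

iso-induced : ∀ G H Q → Iso G H → HasInduced H Q → HasInduced G Q
iso-induced G H Q (f , f-adj) (g , g-inj , g-adj) =
  from ∘ g ,
  (λ {x} {y} e → g-inj (trans (sym (strictlyInverseˡ (g x))) (trans (cong to e) (strictlyInverseˡ (g y))))) ,
  (λ u v → trans (sym (f-adj _ _))
    (trans (cong₂ (adj H) (strictlyInverseˡ (g u)) (strictlyInverseˡ (g v))) (g-adj u v)))
  where open Inverse f

-- Preservation of freeness under the operations

module _ (str : GraphOn (Fin 5)) (ob : Obstruction (GraphOn.adj str)) where
  private
    Q : Graph
    Q = mkGraph (Fin 5) str
    q : Pattern
    q = GraphOn.adj str
  open Obstruction ob

  -- Two vertices with the same image would have the same row in `q`, contradicting `twin-free`.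
  inducedMap⇒induced : ∀ G → InducedMap G Q → HasInduced G Q
  inducedMap⇒induced G (f , f-adj) =
    f , (λ {i} {j} e → twin-free i j λ k →
      trans (sym (f-adj i k)) (trans (cong (λ u → adj G u (f k)) e) (f-adj j k))) , f-adj

  private
    colour : ∀ {k} (P : (Fin 5 → Fin k) → Set) → ∀Colouring k P → (f : Fin 5 → Fin k) → P (lookup (tabulate f))
    colour _ all f = all (f 0F) (f 1F) (f 2F) (f 3F) (f 4F)

  c5-free : ¬ HasInduced C5 Q
  c5-free (f , _ , f-adj) with colour (CycleOutcome q) cycle-outcome f
  ... | i , j , ne = ne (trans (sym (f-adj i j))
    (sym (cong₂ c5adj (lookup∘tabulate f i) (lookup∘tabulate f j))))

  split-free : ∀ G → IsSplit G → ¬ HasInduced G Q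
  split-free G (p , clique , stable) (f , f-inj , f-adj) =
    absurd (colour (SplitOutcome q) split-outcome (side ∘ p ∘ f))
    where
    side : Bool → Fin 2
    side true  = 1F
    side false = 0F
    side⁻¹₁ : ∀ {e} → side e ≡ 1F → e ≡ true
    side⁻¹₁ {true} _ = refl
    side⁻¹₀ : ∀ {e} → side e ≡ 0F → e ≡ false
    side⁻¹₀ {false} _ = refl
    c : ∀ i → lookup (tabulate (side ∘ p ∘ f)) i ≡ side (p (f i))
    c = lookup∘tabulate (side ∘ p ∘ f)
    absurd : ¬ SplitOutcome q (lookup (tabulate (side ∘ p ∘ f)))
    absurd (i , j , i≢j , inj₁ (ci , cj , e)) = true≢false (trans
      (sym (clique (f i) (f j) (i≢j ∘ f-inj) (side⁻¹₁ (trans (sym (c i)) ci)) (side⁻¹₁ (trans (sym (c j)) cj))))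
      (trans (f-adj i j) e))
    absurd (i , j , i≢j , inj₂ (ci , cj , e)) = true≢false (trans (sym e) (trans (sym (f-adj i j))
      (stable (f i) (f j) (side⁻¹₀ (trans (sym (c i)) ci)) (side⁻¹₀ (trans (sym (c j)) cj)))))

  -- By homogeneity no vertex of the copy outside `H` is mixed on `H`. So the copy lies in `H`, or
  -- it meets `H` at most once and `contract` moves it into `G₀`.
  substitute-free : ∀ G₀ x H → ¬ HasInduced G₀ Q → ¬ HasInduced H Q → ¬ HasInduced (substitute G₀ x H) Q
  substitute-free G₀ x H free₀ freeH (f , f-inj , f-adj) = absurd (colour (SubstOutcome q) subst-outcome (part ∘ f))
    where
    S : Graph
    S = substitute G₀ x H
    part : V S → Fin 2
    part (inj₁ _) = 0F
    part (inj₂ _) = 1F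
    c : ∀ i → lookup (tabulate (part ∘ f)) i ≡ part (f i)
    c = lookup∘tabulate (part ∘ f)
    contract : V S → V G₀
    contract (inj₁ (v , _)) = v
    contract (inj₂ _) = x
    contract-adj : ∀ u v → (part u ≡ 1F → part v ≡ 1F → u ≡ v) →
                   adj G₀ (contract u) (contract v) ≡ adj S u v
    contract-adj (inj₁ _) (inj₁ _) _ = refl
    contract-adj (inj₁ _) (inj₂ _) _ = refl
    contract-adj (inj₂ _) (inj₁ _) _ = adj-sym G₀ _ _
    contract-adj (inj₂ h) (inj₂ h′) same with same refl refl
    ... | refl = trans (adj-irrefl G₀ x) (sym (adj-irrefl H h))
    inH : ∀ u → part u ≡ 1F → ∃ λ h → u ≡ inj₂ h
    inH (inj₂ h) _ = h , refl
    homogeneous : ∀ u v w → part u ≡ 0F → part v ≡ 1F → part w ≡ 1F → adj S u v ≡ adj S u w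
    homogeneous (inj₁ _) (inj₂ _) (inj₂ _) _ _ _ = refl
    absurd : ¬ SubstOutcome q (lookup (tabulate (part ∘ f)))
    absurd (inj₁ all) = freeH (inducedMap⇒induced H ((λ i → proj₁ (h i)) , λ i j →
        trans (sym (cong₂ (adj S) (proj₂ (h i)) (proj₂ (h j)))) (f-adj i j)))
      where
      h : ∀ i → ∃ λ h → f i ≡ inj₂ h
      h i = inH (f i) (trans (sym (c i)) (all i))
    absurd (inj₂ (inj₁ (i , lone))) = free₀ (inducedMap⇒induced G₀ (contract ∘ f , λ j k →
      trans (contract-adj (f j) (f k) λ pj pk →
               cong f (trans (lone j (trans (c j) pj)) (sym (lone k (trans (c k) pk)))))
            (f-adj j k)))
    absurd (inj₂ (inj₂ (k , ck , i , ci , e , j , cj , e′))) = true≢false (trans (sym e) (trans (sym (f-adj k i))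
      (trans (homogeneous (f k) (f i) (f j) (trans (sym (c k)) ck) (trans (sym (c i)) ci) (trans (sym (c j)) cj))
        (trans (f-adj k j) e′))))

  module _ {A B C L T : Set} (G₁ : GraphOn (V₁ A B L T)) (G₂ : GraphOn (V₂ B C L T))
           (cp : Composable G₁ G₂) where
    private
      module G₁ = GraphOn G₁
      module G₂ = GraphOn G₂
      U : Graph
      U = splitUnification G₁ G₂ cp
    open Composable cp

    private
      colourU : V U → Fin 5
      colourU (aᵤ _) = 𝐚
      colourU (bᵤ _) = 𝐛
      colourU (cᵤ _) = 𝐜
      colourU (lᵤ _) = 𝐥
      colourU (tᵤ _) = 𝐭

      respects : ∀ u v → u ≢ v → ¬ Violates (kind (colourU u) (colourU v)) (adj U u v)
      respects (lᵤ x) (lᵤ y) ne e = true≢false (trans (sym (L-clique x y (ne ∘ cong lᵤ))) e)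
      respects (aᵤ x) (bᵤ y) _ e = true≢false (trans (sym (A-complete-B x y)) e)
      respects (lᵤ x) (bᵤ y) _ e = true≢false
        (trans (sym (L-complete-B x y)) (trans (same-BLT (l x) (b y)) e))
      respects (lᵤ x) (cᵤ y) _ e = true≢false (trans (sym (L-complete-C x y)) e)
      respects (tᵤ x) (tᵤ y) _ e = true≢false (trans (sym e) (T-stable x y))
      respects (aᵤ x) (tᵤ y) _ e = true≢false (trans (sym e) (A-anti-T x y))
      respects (aᵤ x) (cᵤ y) _ ()
      respects (tᵤ x) (cᵤ y) _ e = true≢false (trans (sym e) (T-anti-C x y))

      toG₂ : V U → V₂ B C L T
      toG₂ (aᵤ _) = a*
      toG₂ (bᵤ y) = b₂ y
      toG₂ (cᵤ y) = c₂ y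
      toG₂ (lᵤ y) = l₂ y
      toG₂ (tᵤ y) = t₂ y

      toG₁ : V U → V₁ A B L T
      toG₁ (aᵤ y) = a₁ y
      toG₁ (bᵤ y) = b₁ y
      toG₁ (cᵤ _) = c*
      toG₁ (lᵤ y) = l₁ y
      toG₁ (tᵤ y) = t₁ y

      Lone₂ : V U → V U → Set
      Lone₂ u v = (colourU u ≡ 𝐚 → colourU v ≡ 𝐚 → u ≡ v) × (colourU u ≡ 𝐚 → colourU v ≡ 𝐥 → adj U u v ≡ true)

      -- Towards B, C and T, `a*` agrees with every vertex of A by composability; towards A and L
      -- the agreement is what `Lone₂` supplies.
      toG₂-a* : ∀ x v → Lone₂ (aᵤ x) v → G₂.adj a* (toG₂ v) ≡ adj U (aᵤ x) v
      toG₂-a* x (aᵤ _) (s , _) with s refl refl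
      ... | refl = trans (G₂.adj-irrefl a*) (sym (G₁.adj-irrefl (a₁ x)))
      toG₂-a* x (bᵤ y) _ = trans (a*-complete-B y) (sym (A-complete-B x y))
      toG₂-a* x (cᵤ y) _ = a*-anti-C y
      toG₂-a* x (lᵤ y) (_ , s) = trans (a*-complete-L y) (sym (s refl refl))
      toG₂-a* x (tᵤ y) _ = trans (a*-anti-T y) (sym (A-anti-T x y))

      toG₂-adj : ∀ u v → Lone₂ u v → Lone₂ v u → G₂.adj (toG₂ u) (toG₂ v) ≡ adj U u v
      toG₂-adj (aᵤ x) v p _ = toG₂-a* x v p
      toG₂-adj u (aᵤ x) _ p = trans (G₂.adj-sym _ _) (trans (toG₂-a* x u p) (adj-sym U (aᵤ x) u))
      toG₂-adj (bᵤ x) (bᵤ y) _ _ = same-BLT (b x) (b y)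
      toG₂-adj (bᵤ x) (cᵤ y) _ _ = refl
      toG₂-adj (bᵤ x) (lᵤ y) _ _ = same-BLT (b x) (l y)
      toG₂-adj (bᵤ x) (tᵤ y) _ _ = same-BLT (b x) (t y)
      toG₂-adj (cᵤ x) (bᵤ y) _ _ = refl
      toG₂-adj (cᵤ x) (cᵤ y) _ _ = refl
      toG₂-adj (cᵤ x) (lᵤ y) _ _ = refl
      toG₂-adj (cᵤ x) (tᵤ y) _ _ = refl
      toG₂-adj (lᵤ x) (bᵤ y) _ _ = same-BLT (l x) (b y)
      toG₂-adj (lᵤ x) (cᵤ y) _ _ = refl
      toG₂-adj (lᵤ x) (lᵤ y) _ _ = same-BLT (l x) (l y)
      toG₂-adj (lᵤ x) (tᵤ y) _ _ = same-BLT (l x) (t y)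
      toG₂-adj (tᵤ x) (bᵤ y) _ _ = same-BLT (t x) (b y)
      toG₂-adj (tᵤ x) (cᵤ y) _ _ = refl
      toG₂-adj (tᵤ x) (lᵤ y) _ _ = same-BLT (t x) (l y)
      toG₂-adj (tᵤ x) (tᵤ y) _ _ = same-BLT (t x) (t y)

      Lone₁ : V U → V U → Set
      Lone₁ u v = (colourU u ≡ 𝐜 → colourU v ≡ 𝐜 → u ≡ v) × (colourU u ≡ 𝐜 → colourU v ≡ 𝐛 → adj U u v ≡ true)

      toG₁-c* : ∀ x v → Lone₁ (cᵤ x) v → G₁.adj c* (toG₁ v) ≡ adj U (cᵤ x) v
      toG₁-c* x (aᵤ y) _ = c*-anti-A y
      toG₁-c* x (bᵤ y) (_ , s) = trans (c*-complete-B y) (sym (s refl refl))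
      toG₁-c* x (cᵤ _) (s , _) with s refl refl
      ... | refl = trans (G₁.adj-irrefl c*) (sym (G₂.adj-irrefl (c₂ x)))
      toG₁-c* x (lᵤ y) _ = trans (c*-complete-L y) (trans (sym (L-complete-C y x)) (G₂.adj-sym _ _))
      toG₁-c* x (tᵤ y) _ = trans (c*-anti-T y) (trans (sym (T-anti-C y x)) (G₂.adj-sym _ _))

      toG₁-adj : ∀ u v → Lone₁ u v → Lone₁ v u → G₁.adj (toG₁ u) (toG₁ v) ≡ adj U u v
      toG₁-adj (cᵤ x) v p _ = toG₁-c* x v p
      toG₁-adj u (cᵤ x) _ p = trans (G₁.adj-sym _ _) (trans (toG₁-c* x u p) (adj-sym U (cᵤ x) u))
      toG₁-adj (aᵤ x) (aᵤ y) _ _ = refl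
      toG₁-adj (aᵤ x) (bᵤ y) _ _ = refl
      toG₁-adj (aᵤ x) (lᵤ y) _ _ = refl
      toG₁-adj (aᵤ x) (tᵤ y) _ _ = refl
      toG₁-adj (bᵤ x) (aᵤ y) _ _ = refl
      toG₁-adj (bᵤ x) (bᵤ y) _ _ = refl
      toG₁-adj (bᵤ x) (lᵤ y) _ _ = refl
      toG₁-adj (bᵤ x) (tᵤ y) _ _ = refl
      toG₁-adj (lᵤ x) (aᵤ y) _ _ = refl
      toG₁-adj (lᵤ x) (bᵤ y) _ _ = refl
      toG₁-adj (lᵤ x) (lᵤ y) _ _ = refl
      toG₁-adj (lᵤ x) (tᵤ y) _ _ = refl
      toG₁-adj (tᵤ x) (aᵤ y) _ _ = refl
      toG₁-adj (tᵤ x) (bᵤ y) _ _ = refl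
      toG₁-adj (tᵤ x) (lᵤ y) _ _ = refl
      toG₁-adj (tᵤ x) (tᵤ y) _ _ = refl

      B-homogeneous : ∀ u v w → colourU u ≡ 𝐜 → colourU v ≡ 𝐛 → colourU w ≡ 𝐛 → adj U v w ≡ false →
                      adj U u v ≡ true → adj U u w ≡ false → ⊥
      B-homogeneous (cᵤ z) (bᵤ y) (bᵤ y′) _ _ _ e p n =
        -- `y` is reached by the empty path and `y′` by a single step; `same-BLT` moves the non-edge
        -- from `G₁` to `G₂`.
        C-not-mixed z y (_ , _ , (y , refl , ε) , (y′ , refl , trans (same-BLT (b y) (b y′)) e ◅ ε) , p , n)

    unification-free : ¬ HasInduced (mkGraph _ G₁) Q → ¬ HasInduced (mkGraph _ G₂) Q → ¬ HasInduced U Q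
    unification-free free₁ free₂ (f , f-inj , f-adj) = absurd (colour (UnifOutcome q) unif-outcome (colourU ∘ f))
      where
      c : ∀ i → lookup (tabulate (colourU ∘ f)) i ≡ colourU (f i)
      c = lookup∘tabulate (colourU ∘ f)
      absurd : ¬ UnifOutcome q (lookup (tabulate (colourU ∘ f)))
      absurd (inj₁ (i , j , i≢j , violates)) = respects (f i) (f j) (i≢j ∘ f-inj)
        (subst₂ Violates (cong₂ kind (c i) (c j)) (sym (f-adj i j)) violates)
      absurd (inj₂ (inj₁ (i , lone))) = free₂ (inducedMap⇒induced (mkGraph _ G₂) (toG₂ ∘ f , λ j k →
        trans (toG₂-adj (f j) (f k) (lone₂ j k) (lone₂ k j)) (f-adj j k)))
        where
        at-i : ∀ j → colourU (f j) ≡ 𝐚 → j ≡ i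
        at-i j cj = proj₁ (lone j) (trans (c j) cj)
        lone₂ : ∀ j k → Lone₂ (f j) (f k)
        lone₂ j k = (λ cj ck → cong f (trans (at-i j cj) (sym (at-i k ck)))) , λ cj ck →
          -- Only `i` can have colour 𝐚, so `j` is `i` and inherits its completeness to the vertices
          -- coloured 𝐥.
          trans (f-adj j k) (trans (cong (λ m → q m k) (at-i j cj))
            (proj₂ (lone k) (trans (c i) (trans (cong (colourU ∘ f) (sym (at-i j cj))) cj)) (trans (c k) ck)))
      absurd (inj₂ (inj₂ (inj₁ (i , lone)))) = free₁ (inducedMap⇒induced (mkGraph _ G₁) (toG₁ ∘ f , λ j k →
        trans (toG₁-adj (f j) (f k) (lone₁ j k) (lone₁ k j)) (f-adj j k)))
        where
        at-i : ∀ j → colourU (f j) ≡ 𝐜 → j ≡ i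
        at-i j cj = proj₁ (lone j) (trans (c j) cj)
        lone₁ : ∀ j k → Lone₁ (f j) (f k)
        lone₁ j k = (λ cj ck → cong f (trans (at-i j cj) (sym (at-i k ck)))) , λ cj ck →
          trans (f-adj j k) (trans (cong (λ m → q m k) (at-i j cj))
            (proj₂ (lone k) (trans (c i) (trans (cong (colourU ∘ f) (sym (at-i j cj))) cj)) (trans (c k) ck)))
      absurd (inj₂ (inj₂ (inj₂ (i , ci , j , cj , e , k , ck , p , n)))) =
        B-homogeneous (f k) (f i) (f j) (trans (sym (c k)) ck) (trans (sym (c i)) ci) (trans (sym (c j)) cj)
          (trans (f-adj i j) e) (trans (f-adj k i) p) (trans (f-adj k j) n)

-- Complementation

complement-adj : ∀ G {u v} → u ≢ v → adj (complement G) u v ≡ not (adj G u v)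
complement-adj G {u} {v} ne with _≟_ G u v
... | yes e = ⊥-elim (ne e)
... | no _  = refl

complement-involutive : ∀ G u v → adj (complement (complement G)) u v ≡ adj G u v
complement-involutive G u v with _≟_ G u v
... | yes refl = sym (adj-irrefl G u)
... | no _     = BoolP.not-involutive (adj G u v)

complement-induced : ∀ G H → HasInduced G H → HasInduced (complement G) (complement H)
complement-induced G H (f , f-inj , f-adj) = f , f-inj , co-adj
  where
  co-adj : ∀ u v → adj (complement G) (f u) (f v) ≡ adj (complement H) u v
  co-adj u v with _≟_ H u v
  ... | yes refl = adj-irrefl (complement G) (f u)
  ... | no ne    = trans (complement-adj G (ne ∘ f-inj)) (cong not (f-adj u v))

-- Complementation exchanges the two forbidden graphs; the second component meets the double
-- complement of `P5`, which is compared with `P5` pointwise.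
complement-free : ∀ G → P5coP5Free G → P5coP5Free (complement G)
complement-free G (freeP5 , freeCoP5) =
  (λ h → freeCoP5 (uncomplement P5 h)) ,
  (λ { (f , f-inj , f-adj) → freeP5 (f , f-inj , λ u v → trans (sym (complement-involutive G _ _))
    (trans (proj₂ (proj₂ (complement-induced (complement G) (complement P5) (f , f-inj , f-adj))) u v)
      (complement-involutive P5 u v))) })
  where
  uncomplement : ∀ H → HasInduced (complement G) H → HasInduced G (complement H)
  uncomplement H h with complement-induced (complement G) H h
  ... | f , f-inj , f-adj = f , f-inj , λ u v → trans (sym (complement-involutive G _ _)) (f-adj u v)

free-from-complement : ∀ G → P5coP5Free (complement G) → P5coP5Free G
free-from-complement G (freeP5 , freeCoP5) =
  (λ h → freeCoP5 (complement-induced G P5 h)) ,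
  (λ { h@(f , f-inj , _) → freeP5 (f , f-inj , λ u v →
    trans (proj₂ (proj₂ (complement-induced G (complement P5) h)) u v) (complement-involutive P5 u v)) })

iso-sym : ∀ G H → Iso G H → Iso H G
iso-sym G H (f , f-adj) = ↔-sym f , λ u v → trans (sym (f-adj _ _))
  (cong₂ (adj H) (strictlyInverseˡ u) (strictlyInverseˡ v))
  where open Inverse f

class⇒free : ∀ G → InClass G → P5coP5Free G
class⇒free _ (pentagon G i) =
  (λ h → c5-free (str P5) p5-obstruction (iso-induced C5 G P5 i h)) ,
  (λ h → c5-free (str coP5) coP5-obstruction (iso-induced C5 G coP5 i h))
class⇒free _ (split G _ s) = split-free (str P5) p5-obstruction G s , split-free (str coP5) coP5-obstruction G s
class⇒free _ (subst G₀ x H g h) =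
  let free₀ , cofree₀ = class⇒free G₀ g
      freeH , cofreeH = class⇒free H h
  in substitute-free (str P5) p5-obstruction G₀ x H free₀ freeH ,
     substitute-free (str coP5) coP5-obstruction G₀ x H cofree₀ cofreeH
class⇒free _ (unif G₁ G₂ cp g₁ g₂) =
  let free₁ , cofree₁ = class⇒free (mkGraph _ G₁) g₁
      free₂ , cofree₂ = class⇒free (mkGraph _ G₂) g₂
  in unification-free (str P5) p5-obstruction G₁ G₂ cp free₁ free₂ ,
     unification-free (str coP5) coP5-obstruction G₁ G₂ cp cofree₁ cofree₂
class⇒free _ (counif G₁ G₂ cp g₁ g₂ G i) =
  -- The induction hypotheses concern the complements; freeness passes to `G₁` and `G₂`, then to
  -- their unification, and finally back through the complement to `G`.
  let free₁ , cofree₁ = free-from-complement (mkGraph _ G₁) (class⇒free _ g₁)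
      free₂ , cofree₂ = free-from-complement (mkGraph _ G₂) (class⇒free _ g₂)
      freeU   = unification-free (str P5) p5-obstruction G₁ G₂ cp free₁ free₂
      cofreeU = unification-free (str coP5) coP5-obstruction G₁ G₂ cp cofree₁ cofree₂
  in free-from-complement G
       ((λ h → freeU (iso-induced U (complement G) P5 i⁻¹ h)) ,
        (λ h → cofreeU (iso-induced U (complement G) coP5 i⁻¹ h)))
  where
  U : Graph
  U = splitUnification G₁ G₂ cp
  i⁻¹ : Iso U (complement G)
  i⁻¹ = iso-sym (complement G) U i
class⇒free _ (iso G H i g) =
  let freeG , cofreeG = class⇒free G g
  in (λ h → freeG (iso-induced G H P5 i h)) , (λ h → cofreeG (iso-induced G H coP5 i h))

-- The decomposition of graphs with a 2K₂

-- Repetitions are allowed: the induction measures a graph by the length of such a list.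
Listing : Set → Set
Listing V = Σ (List V) λ xs → ∀ v → v ∈ xs

bool-cases : ∀ e → e ≡ true ⊎ e ≡ false
bool-cases true  = inj₁ refl
bool-cases false = inj₂ refl

not-≡ : ∀ {d e} → not d ≡ e → d ≡ not e
not-≡ p = trans (sym (BoolP.not-involutive _)) (cong not p)

¬true⇒false : ∀ {e} → ¬ e ≡ true → e ≡ false
¬true⇒false {e} n with bool-cases e
... | inj₁ p = ⊥-elim (n p)
... | inj₂ f = f

module Adjacency (G : Graph) where
  infix 4 _~_ _≁_
  _~_ _≁_ : V G → V G → Set
  u ~ v = adj G u v ≡ true
  u ≁ v = adj G u v ≡ false

  _~?_ : ∀ u v → Dec (u ~ v)
  u ~? v = adj G u v BoolP.≟ true

  _≁?_ : ∀ u v → Dec (u ≁ v)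
  u ≁? v = adj G u v BoolP.≟ false

  sy : ∀ {u v e} → adj G u v ≡ e → adj G v u ≡ e
  sy {u} {v} p = trans (adj-sym G v u) p

module Search {V : Set} (listing : Listing V) where
  private
    xs : List V
    xs = proj₁ listing

  some? : ∀ {P : V → Set} → (∀ v → Dec (P v)) → Dec (∃ P)
  some? P? with Any.any? P? xs
  ... | yes p = yes (let v , _ , pv = find p in v , pv)
  ... | no ¬p = no λ (v , pv) → ¬p (lose (proj₂ listing v) pv)

  every? : ∀ {P : V → Set} → (∀ v → Dec (P v)) → Dec (∀ v → P v)
  every? P? with All.all? P? xs
  ... | yes p = yes λ v → All.lookup p (proj₂ listing v)
  ... | no ¬p = no λ p → ¬p (All.tabulate λ {v} _ → p v)

  failing : ∀ {P : V → Set} → (∀ v → Dec (P v)) → ¬ (∀ v → P v) → ∃ λ v → ¬ P v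
  failing P? ¬all with some? (λ v → ¬? (P? v))
  ... | yes p = p
  ... | no ¬p = ⊥-elim (¬all λ v → decide v (P? v))
    where
    decide : ∀ v → Dec _ → _
    decide v (yes p) = p
    decide v (no n)  = ⊥-elim (¬p (v , n))

-- The termination measure of `grow`: it drops as soon as a listed vertex is added to `S`.
missing : {V : Set} → (V → Bool) → List V → ℕ
missing S [] = 0
missing S (v ∷ vs) = if S v then missing S vs else suc (missing S vs)

missing-mono : ∀ {V} (S S′ : V → Bool) → (∀ v → S v ≡ true → S′ v ≡ true) →
               ∀ vs → missing S′ vs ≤ missing S vs
missing-mono S S′ ⊆ [] = z≤n
missing-mono S S′ ⊆ (v ∷ vs) with S v in e | S′ v in e′
... | true  | true  = missing-mono S S′ ⊆ vs
... | true  | false = ⊥-elim (true≢false (trans (sym (⊆ v e)) e′))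
... | false | true  = ℕP.m≤n⇒m≤1+n (missing-mono S S′ ⊆ vs)
... | false | false = s≤s (missing-mono S S′ ⊆ vs)

missing-strict : ∀ {V} (S S′ : V → Bool) → (∀ v → S v ≡ true → S′ v ≡ true) →
                 ∀ {v vs} → v ∈ vs → S v ≡ false → S′ v ≡ true → missing S′ vs < missing S vs
missing-strict S S′ ⊆ {v} {_ ∷ vs} (here refl) e e′ rewrite e | e′ = s≤s (missing-mono S S′ ⊆ vs)
missing-strict S S′ ⊆ {v} {w ∷ vs} (there v∈vs) e e′ with S w in d | S′ w in d′
... | true  | true  = missing-strict S S′ ⊆ v∈vs e e′
... | true  | false = ⊥-elim (true≢false (trans (sym (⊆ w d)) d′))
... | false | true  = ℕP.m≤n⇒m≤1+n (missing-strict S S′ ⊆ v∈vs e e′)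
... | false | false = s≤s (missing-strict S S′ ⊆ v∈vs e e′)

-- Vertex sets, greedy growth and connectedness

module Sets (G : Graph) where
  insert : V G → (V G → Bool) → V G → Bool
  insert x S v = if does (_≟_ G v x) then true else S v

  insert-new : ∀ x S → insert x S x ≡ true
  insert-new x S with _≟_ G x x
  ... | yes _ = refl
  ... | no ne = ⊥-elim (ne refl)

  insert-old : ∀ x S v → S v ≡ true → insert x S v ≡ true
  insert-old x S v e with _≟_ G v x
  ... | yes _ = refl
  ... | no _  = e

  insert-cases : ∀ x S v → insert x S v ≡ true → v ≡ x ⊎ S v ≡ true
  insert-cases x S v e with _≟_ G v x
  ... | yes p = inj₁ p
  ... | no _  = inj₂ e

  insert-false : ∀ x S v → v ≢ x → S v ≡ false → insert x S v ≡ false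
  insert-false x S v ne e with _≟_ G v x
  ... | yes p = ⊥-elim (ne p)
  ... | no _  = e

  singleton : V G → V G → Bool
  singleton x = insert x λ _ → false

  pair : V G → V G → V G → Bool
  pair u v = insert v (singleton u)

  pair-left : ∀ u v → pair u v u ≡ true
  pair-left u v = insert-old v (singleton u) u (insert-new u λ _ → false)

  pair-right : ∀ u v → pair u v v ≡ true
  pair-right u v = insert-new v (singleton u)

  singleton-cases : ∀ u x → singleton u x ≡ true → x ≡ u
  singleton-cases u x e with insert-cases u (λ _ → false) x e
  ... | inj₁ p = p

  pair-cases : ∀ u v x → pair u v x ≡ true → x ≡ u ⊎ x ≡ v
  pair-cases u v x e with insert-cases v (singleton u) x e
  ... | inj₁ p = inj₂ p
  ... | inj₂ p = inj₁ (singleton-cases u x p)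

  pair-false : ∀ u v x → x ≢ u → x ≢ v → pair u v x ≡ false
  pair-false u v x x≢u x≢v = insert-false v (singleton u) x x≢v (insert-false u (λ _ → false) x x≢u refl)

  -- Vertices are added until `Q` holds, and each addition lowers `missing`. In the uses `P` is an
  -- invariant such as connectedness, and `Q` says that no further vertex can be added.
  grow : Listing (V G) → (P Q : (V G → Bool) → Set) →
         (∀ S → P S → Q S ⊎ ∃ λ v → S v ≡ false × P (insert v S)) →
         ∀ S → P S → ∃ λ S′ → (∀ v → S v ≡ true → S′ v ≡ true) × P S′ × Q S′
  grow (xs , all) P Q step S p = go (suc (missing S xs)) S ℕP.≤-refl p
    where
    go : ∀ n S → missing S xs < n → P S → ∃ λ S′ → (∀ v → S v ≡ true → S′ v ≡ true) × P S′ × Q S′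
    go (suc n) S (s≤s le) p with step S p
    ... | inj₁ q = S , (λ _ e → e) , p , q
    ... | inj₂ (v , v∉S , p′) with go n (insert v S)
            (ℕP.<-≤-trans (missing-strict S (insert v S) (insert-old v S) (all v) v∉S (insert-new v S)) le) p′
    ... | S′ , ⊆ , r = S′ , (λ u e → ⊆ u (insert-old v S u e)) , r

  -- Stated by cuts instead of paths, the only form in which connectedness is used.
  Connected : (V G → Bool) → Set
  Connected S = ∀ (f : V G → Bool) u v → S u ≡ true → S v ≡ true → f u ≡ true → f v ≡ false →
    ∃ λ p → ∃ λ q → S p ≡ true × S q ≡ true × adj G p q ≡ true × f p ≡ true × f q ≡ false

  connected-singleton : ∀ x → Connected (singleton x)
  connected-singleton x f u v u∈ v∈ fu fv
    with singleton-cases x u u∈ | singleton-cases x v v∈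
  ... | refl | refl = ⊥-elim (true≢false (trans (sym fu) fv))

  -- A cut with `s` and `x` on different sides is crossed by the edge between them. Otherwise the
  -- end of the cut on the opposite side lies in `S`, and connectedness of `S` gives an edge
  -- crossing between it and `s`.
  connected-insert : ∀ S s x → Connected S → S s ≡ true → adj G s x ≡ true → Connected (insert x S)
  connected-insert S s x conn s∈ s~x f u v u∈ v∈ fu fv with f s in fs | f x in fx
  ... | true  | false = s , x , insert-old x S s s∈ , insert-new x S , s~x , fs , fx
  ... | false | true  = x , s , insert-new x S , insert-old x S s s∈ , trans (adj-sym G x s) s~x , fx , fs
  ... | true  | true  = old
    where
    old : ∃ λ p → ∃ λ q → insert x S p ≡ true × insert x S q ≡ true × adj G p q ≡ true × f p ≡ true × f q ≡ false
    old with insert-cases x S v v∈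
    ... | inj₁ refl = ⊥-elim (true≢false (trans (sym fx) fv))
    ... | inj₂ v∈S with conn f s v s∈ v∈S fs fv
    ... | p , q , p∈ , q∈ , r = p , q , insert-old x S p p∈ , insert-old x S q q∈ , r
  ... | false | false = old
    where
    old : ∃ λ p → ∃ λ q → insert x S p ≡ true × insert x S q ≡ true × adj G p q ≡ true × f p ≡ true × f q ≡ false
    old with insert-cases x S u u∈
    ... | inj₁ refl = ⊥-elim (true≢false (trans (sym fu) fx))
    ... | inj₂ u∈S with conn f u s u∈S s∈ fu fs
    ... | p , q , p∈ , q∈ , r = p , q , insert-old x S p p∈ , insert-old x S q q∈ , r

  connected-pair : ∀ u v → adj G u v ≡ true → Connected (pair u v)
  connected-pair u v u~v =
    connected-insert (singleton u) u v (connected-singleton u) (insert-new u λ _ → false) u~v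

-- Forbidden subgraphs given by their vertices

NoC5 : Graph → Set
NoC5 G = ∀ a b′ c d e → adj G a b′ ≡ true → adj G b′ c ≡ true → adj G c d ≡ true → adj G d e ≡ true →
  adj G e a ≡ true → adj G a c ≡ false → adj G a d ≡ false → adj G b′ d ≡ false →
  adj G b′ e ≡ false → adj G c e ≡ false → ⊥

-- The ten pairs above the diagonal determine the others by symmetry and irreflexivity.
inducedMap5 : ∀ G (str : GraphOn (Fin 5)) → let q = GraphOn.adj str in ∀ a b′ c d e →
  adj G a b′ ≡ q 0F 1F → adj G a c ≡ q 0F 2F → adj G a d ≡ q 0F 3F → adj G a e ≡ q 0F 4F →
  adj G b′ c ≡ q 1F 2F → adj G b′ d ≡ q 1F 3F → adj G b′ e ≡ q 1F 4F →
  adj G c d ≡ q 2F 3F → adj G c e ≡ q 2F 4F → adj G d e ≡ q 3F 4F →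
  ∀ i j → adj G (lookup (a ∷ b′ ∷ c ∷ d ∷ e ∷ []) i) (lookup (a ∷ b′ ∷ c ∷ d ∷ e ∷ []) j) ≡ q i j
inducedMap5 G str a b′ c d e ab ac ad ae bc bd be cd ce de = go
  where
  open GraphOn str using () renaming (adj to q; adj-sym to q-sym; adj-irrefl to q-irr)
  vs : Vec (V G) 5
  vs = a ∷ b′ ∷ c ∷ d ∷ e ∷ []
  diag : ∀ i → adj G (lookup vs i) (lookup vs i) ≡ q i i
  diag i = trans (adj-irrefl G _) (sym (q-irr i))
  flip : ∀ i j → adj G (lookup vs i) (lookup vs j) ≡ q i j → adj G (lookup vs j) (lookup vs i) ≡ q j i
  flip i j p = trans (adj-sym G _ _) (trans p (q-sym i j))
  go : ∀ i j → adj G (lookup vs i) (lookup vs j) ≡ q i j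
  go 0F 0F = diag 0F
  go 0F 1F = ab
  go 0F 2F = ac
  go 0F 3F = ad
  go 0F 4F = ae
  go 1F 0F = flip 0F 1F ab
  go 1F 1F = diag 1F
  go 1F 2F = bc
  go 1F 3F = bd
  go 1F 4F = be
  go 2F 0F = flip 0F 2F ac
  go 2F 1F = flip 1F 2F bc
  go 2F 2F = diag 2F
  go 2F 3F = cd
  go 2F 4F = ce
  go 3F 0F = flip 0F 3F ad
  go 3F 1F = flip 1F 3F bd
  go 3F 2F = flip 2F 3F cd
  go 3F 3F = diag 3F
  go 3F 4F = de
  go 4F 0F = flip 0F 4F ae
  go 4F 1F = flip 1F 4F be
  go 4F 2F = flip 2F 4F ce
  go 4F 3F = flip 3F 4F de
  go 4F 4F = diag 4F

noP5 : ∀ G → P5coP5Free G → ∀ a b′ c d e →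
  adj G a b′ ≡ true → adj G b′ c ≡ true → adj G c d ≡ true → adj G d e ≡ true →
  adj G a c ≡ false → adj G a d ≡ false → adj G a e ≡ false →
  adj G b′ d ≡ false → adj G b′ e ≡ false → adj G c e ≡ false → ⊥
noP5 G (freeP5 , _) a b′ c d e ab bc cd de ac ad ae bd be ce =
  freeP5 (inducedMap⇒induced (str P5) p5-obstruction G
    (_ , inducedMap5 G (str P5) a b′ c d e ab ac ad ae bc bd be cd ce de))

-- The square x a y c with a roof r over the edge x a.
noHouse : ∀ G → P5coP5Free G → ∀ x a y c r →
  adj G x a ≡ true → adj G a y ≡ true → adj G y c ≡ true → adj G c x ≡ true →
  adj G x y ≡ false → adj G a c ≡ false →
  adj G r x ≡ true → adj G r a ≡ true → adj G r y ≡ false → adj G r c ≡ false → ⊥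
noHouse G (_ , freeCoP5) x a y c r xa ay yc cx xy ac rx ra ry rc =
  -- In the order `x y r c a` exactly the consecutive vertices are non-adjacent: this is the path in
  -- the complement.
  freeCoP5 (inducedMap⇒induced (str coP5) coP5-obstruction G
    (_ , inducedMap5 G (str coP5) x y r c a xy (~ rx) (~ cx) xa (~ ry) yc (~ ay) rc ra (~ ac)))
  where
  ~_ : ∀ {u v e} → adj G u v ≡ e → adj G v u ≡ e
  ~_ {u} {v} p = trans (adj-sym G v u) p

complement-edge : ∀ G {u v} → adj (complement G) u v ≡ true → u ≢ v × adj G u v ≡ false
complement-edge G {u} {v} e with _≟_ G u v | adj G u v in p
... | no ne | false = ne , refl

complement-nonedge : ∀ G {u v} → u ≢ v → adj (complement G) u v ≡ false → adj G u v ≡ true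
complement-nonedge G {u} {v} ne e with adj G u v | complement-adj G ne
... | true  | _ = refl
... | false | p = ⊥-elim (true≢false (trans (sym p) e))

edge-distinct : ∀ G {u v} → adj G u v ≡ true → u ≢ v
edge-distinct G e refl = true≢false (trans (sym e) (adj-irrefl G _))

separated : ∀ G {u v w} → adj G u w ≡ true → adj G v w ≡ false → u ≢ v
separated G p n refl = true≢false (trans (sym p) n)

edge⇒co : ∀ G {u v} → adj G u v ≡ true → adj (complement G) u v ≡ false
edge⇒co G e = trans (complement-adj G (edge-distinct G e)) (cong not e)

nonedge⇒co : ∀ G {u v} → u ≢ v → adj G u v ≡ false → adj (complement G) u v ≡ true
nonedge⇒co G ne e = trans (complement-adj G ne) (cong not e)

complement-noC5 : ∀ G → NoC5 G → NoC5 (complement G)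
complement-noC5 G noC5 a b′ c d e ab bc cd de ea ac ad bd be ce =
  -- The complement of the cycle `a b′ c d e` is the cycle `a c e b′ d`. Two of its consecutive
  -- vertices are distinct because a third one is adjacent to just one of them.
  noC5 a c e b′ d
    (complement-nonedge G (separated H (~ ea) ce) ac)
    (complement-nonedge G (separated H (~ bc) (~ be)) ce)
    (complement-nonedge G (separated H (~ de) bd) (~ be))
    (complement-nonedge G (separated H (~ ab) (~ ad)) bd)
    (complement-nonedge G (separated H (~ cd) ac) (~ ad))
    (non (~ ea)) (non ab) (non (~ bc)) (non cd) (non (~ de))
  where
  H : Graph
  H = complement G
  ~_ : ∀ {u v e} → adj H u v ≡ e → adj H v u ≡ e
  ~_ {u} {v} p = trans (adj-sym H v u) p
  non : ∀ {u v} → adj H u v ≡ true → adj G u v ≡ false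
  non = proj₂ ∘ complement-edge G

-- A split unification described inside `G` by a colouring. The vertices `a` and `c` play `a*` and
-- `c*`, while `a′` and `c′` make both pieces smaller than `G`; `B-twins` is the one-step form of
-- not being mixed on anticomponents.
record Decomposition (G : Graph) : Set where
  open Adjacency G
  field
    κ              : V G → Fin 5
    a a′ c c′      : V G
    a∈A            : κ a ≡ 𝐚
    a′∈A           : κ a′ ≡ 𝐚
    c∈C            : κ c ≡ 𝐜
    c′∈C           : κ c′ ≡ 𝐜
    a≢a′           : a ≢ a′
    c≢c′           : c ≢ c′
    a-L            : ∀ v → κ v ≡ 𝐥 → a ~ v
    c-B            : ∀ v → κ v ≡ 𝐛 → c ~ v
    L-clique       : ∀ u v → κ u ≡ 𝐥 → κ v ≡ 𝐥 → u ≢ v → u ~ v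
    T-stable       : ∀ u v → κ u ≡ 𝐭 → κ v ≡ 𝐭 → u ≁ v
    A-B            : ∀ u v → κ u ≡ 𝐚 → κ v ≡ 𝐛 → u ~ v
    A-T            : ∀ u v → κ u ≡ 𝐚 → κ v ≡ 𝐭 → u ≁ v
    A-C            : ∀ u v → κ u ≡ 𝐚 → κ v ≡ 𝐜 → u ≁ v
    T-C            : ∀ u v → κ u ≡ 𝐭 → κ v ≡ 𝐜 → u ≁ v
    L-B            : ∀ u v → κ u ≡ 𝐥 → κ v ≡ 𝐛 → u ~ v
    L-C            : ∀ u v → κ u ≡ 𝐥 → κ v ≡ 𝐜 → u ~ v
    B-twins        : ∀ y y′ z → κ y ≡ 𝐛 → κ y′ ≡ 𝐛 → κ z ≡ 𝐜 → y ≁ y′ → y ~ z → y′ ~ z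

-- A maximal connected set anticomplete to an edge

module Separation (G : Graph) (listing : Listing (V G)) where
  open Search listing
  open Sets G
  open Adjacency G

  Far : (V G → Bool) → V G → Set
  Far S a = S a ≡ false × (∀ s → S s ≡ true → a ≁ s)

  far? : ∀ S a → Dec (Far S a)
  far? S a = S a BoolP.≟ false ×-dec every? λ s → S s BoolP.≟ true →-dec adj G a s BoolP.≟ false

  FarEdge : (V G → Bool) → Set
  FarEdge S = ∃ λ a → ∃ λ a′ → a ~ a′ × Far S a × Far S a′

  -- Only extensions by one vertex are excluded. Since `x` has a neighbour in `S`, such an extension
  -- stays connected, so it can fail only by leaving no far edge.
  Maximal : (V G → Bool) → Set
  Maximal S = ∀ x s → S x ≡ false → S s ≡ true → x ~ s →
    ∀ a a′ → a ~ a′ → Far S a → Far S a′ → a ≁ x → a′ ≁ x → ⊥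

  far-insert : ∀ S x s a → S s ≡ true → x ~ s → Far S a → a ≁ x → Far (insert x S) a
  far-insert S x s a s∈ x~s (a∉ , far) a≁x =
    insert-false x S a (separated G x~s (far s s∈) ∘ sym) a∉ , λ u u∈ → new u (insert-cases x S u u∈)
    where
    new : ∀ u → u ≡ x ⊎ S u ≡ true → a ≁ u
    new u (inj₁ refl) = a≁x
    new u (inj₂ u∈)   = far u u∈

  maximal-extension : ∀ S → Connected S → FarEdge S →
    ∃ λ S′ → (∀ v → S v ≡ true → S′ v ≡ true) × (Connected S′ × FarEdge S′) × Maximal S′
  maximal-extension S conn far = grow listing _ _ step S (conn , far)
    where
    step : ∀ S → Connected S × FarEdge S →
           Maximal S ⊎ ∃ λ x → S x ≡ false × Connected (insert x S) × FarEdge (insert x S)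
    step S (conn , _) with some? (λ x → S x BoolP.≟ false ×-dec some? λ s → S s BoolP.≟ true ×-dec x ~? s ×-dec
      some? λ a → far? S a ×-dec adj G a x BoolP.≟ false ×-dec
      some? λ a′ → far? S a′ ×-dec adj G a′ x BoolP.≟ false ×-dec a ~? a′)
    ... | no none = inj₁ λ x s x∉ s∈ x~s a a′ a~a′ fa fa′ n n′ →
            none (x , x∉ , s , s∈ , x~s , a , fa , n , a′ , fa′ , n′ , a~a′)
    ... | yes (x , x∉ , s , s∈ , x~s , a , fa , n , a′ , fa′ , n′ , a~a′) =
            inj₂ (x , x∉ , connected-insert S s x conn s∈ (sy x~s) ,
                  a , a′ , a~a′ , far-insert S x s a s∈ x~s fa n , far-insert S x s a′ s∈ x~s fa′ n′)

  module Split (free : P5coP5Free G) (noC5 : NoC5 G)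
               (C : V G → Bool) (conn : Connected C) (farEdge : FarEdge C) (maximal : Maximal C)
               (c₀ c₁ : V G) (c₀∈C : C c₀ ≡ true) (c₁∈C : C c₁ ≡ true) (c₀≢c₁ : c₀ ≢ c₁) where

    A T X B L : V G → Set
    A v = Far C v × ∃ λ a → Far C a × v ~ a
    T v = Far C v × (∀ a → Far C a → v ≁ a)
    X v = C v ≡ false × ∃ λ s → C s ≡ true × v ~ s
    B v = X v × (∀ a → A a → v ~ a)
    L v = X v × ∃ λ a → A a × v ≁ a

    A? : ∀ v → Dec (A v)
    A? v = far? C v ×-dec some? λ a → far? C a ×-dec v ~? a

    X? : ∀ v → Dec (X v)
    X? v = C v BoolP.≟ false ×-dec some? λ s → C s BoolP.≟ true ×-dec v ~? s

    L? : ∀ v → Dec (L v)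
    L? v = X? v ×-dec some? λ a → A? a ×-dec adj G v a BoolP.≟ false

    a₀ : V G
    a₀ = proj₁ farEdge

    A-a₀ : A a₀
    A-a₀ = let a , a′ , a~a′ , fa , fa′ = farEdge in fa , a′ , fa′ , a~a′

    a₀′ : V G
    a₀′ = proj₁ (proj₂ farEdge)

    A-a₀′ : A a₀′
    A-a₀′ = let a , a′ , a~a′ , fa , fa′ = farEdge in fa′ , a , fa , sy a~a′

    a₀≢a₀′ : a₀ ≢ a₀′
    a₀≢a₀′ = edge-distinct G (proj₁ (proj₂ (proj₂ farEdge)))

    classify : ∀ v → C v ≡ true ⊎ A v ⊎ T v ⊎ B v ⊎ L v
    classify v with bool-cases (C v)
    ... | inj₁ v∈C = inj₁ v∈C
    ... | inj₂ v∉C with X? v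
    ... | yes x with L? v
    ...   | yes Lv = inj₂ (inj₂ (inj₂ (inj₂ Lv)))
    ...   | no ¬Lv = inj₂ (inj₂ (inj₂ (inj₁ (x , λ a Aa → ≁false a Aa (bool-cases (adj G v a))))))
      where
      ≁false : ∀ a → A a → adj G v a ≡ true ⊎ adj G v a ≡ false → v ~ a
      ≁false a Aa (inj₁ e) = e
      ≁false a Aa (inj₂ e) = ⊥-elim (¬Lv (x , a , Aa , e))
    classify v | inj₂ v∉C | no ¬x with A? v
    ...   | yes Av = inj₂ (inj₁ Av)
    ...   | no ¬Av = inj₂ (inj₂ (inj₁ (far , λ a fa → ¬true⇒false λ e → ¬Av (far , a , fa , e))))
      where
      far : Far C v
      far = v∉C , λ s s∈ → ¬true⇒false λ e → ¬x (v∉C , s , s∈ , e)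

    far-≁ : ∀ {a s} → Far C a → C s ≡ true → a ≁ s
    far-≁ (_ , f) s∈ = f _ s∈

    -- By maximality of C, every neighbour of C covers each edge of A ∪ T.
    covers : ∀ {x a a′} → X x → Far C a → Far C a′ → a ~ a′ → x ≁ a → x ~ a′
    covers {x} {a} {a′} (x∉ , s , s∈ , x~s) fa fa′ a~a′ x≁a with bool-cases (adj G x a′)
    ... | inj₁ e = e
    ... | inj₂ n = ⊥-elim (maximal x s x∉ s∈ x~s a a′ a~a′ fa fa′ (sy x≁a) (sy n))

    -- `x` misses some `a` in A and covers its neighbour `a′`. If `x` also missed a vertex of C,
    -- connectedness would give an edge `p q` of C with `x` adjacent to `p` only, and `a a′ x p q`
    -- would be a P₅.
    L-C : ∀ {x c} → L x → C c ≡ true → x ~ c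
    L-C {x} {c} (X-x@(_ , s , s∈ , x~s) , a , (fa , a′ , fa′ , a~a′) , x≁a) c∈ with bool-cases (adj G x c)
    ... | inj₁ e = e
    ... | inj₂ n with conn (adj G x) s c s∈ c∈ x~s n
    ... | p , q , p∈ , q∈ , p~q , x~p , x≁q = ⊥-elim (noP5 G free a a′ x p q
          a~a′ (sy (covers X-x fa fa′ a~a′ x≁a)) x~p p~q
          (sy x≁a) (far-≁ fa p∈) (far-≁ fa q∈) (far-≁ fa′ p∈) (far-≁ fa′ q∈) x≁q)

    -- With `x` missing `a` and covering `a′`, and `s` a neighbour of `y` in C, the square
    -- `y a′ x s` would have the roof `a` over `y a′`.
    L-B : ∀ {x y} → L x → B y → x ~ y
    L-B {x} {y} Lx@(X-x , a , Aa@(fa , a′ , fa′ , a~a′) , x≁a) ((_ , s , s∈ , y~s) , y-A) with bool-cases (adj G x y)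
    ... | inj₁ e = e
    ... | inj₂ n = ⊥-elim (noHouse G free y a′ x s a
          (y-A a′ (fa′ , a , fa , sy a~a′)) (sy (covers X-x fa fa′ a~a′ x≁a)) (L-C Lx s∈) (sy y~s)
          (sy n) (far-≁ fa′ s∈) (sy (y-A a Aa)) a~a′ (sy x≁a) (far-≁ fa s∈))

    -- If `y′` missed `c`, cut C into the vertices seen by `y` but not by `y′` and the rest, which
    -- contains a neighbour `s` of `y′`. For an edge `p q` across this cut, `q` sees both, only
    -- `y′`, or neither; together with `a₀` this gives a house, a C₅ or a P₅.
    B-twins : ∀ {y y′ c} → B y → B y′ → C c ≡ true → y ≁ y′ → y ~ c → y′ ~ c
    B-twins {y} {y′} {c} (_ , y-A) ((_ , s , s∈ , y′~s) , y′-A) c∈ y≁y′ y~c with bool-cases (adj G y′ c)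
    ... | inj₁ e = e
    ... | inj₂ y′≁c = ⊥-elim (absurd (conn only-y c s c∈ s∈ (cong₂ (λ p q → p ∧ not q) y~c y′≁c)
                                (trans (cong (λ q → adj G y s ∧ not q) y′~s) (BoolP.∧-zeroʳ _))))
      where
      only-y : V G → Bool
      only-y v = adj G y v ∧ not (adj G y′ v)
      absurd : ¬ (∃ λ p → ∃ λ q → C p ≡ true × C q ≡ true × p ~ q × only-y p ≡ true × only-y q ≡ false)
      absurd (p , q , p∈ , q∈ , p~q , fp , fq) with adj G y p in yp | adj G y′ p in y′p | adj G y q in yq | adj G y′ q in y′q
      ... | true | false | true | true = noHouse G free y q y′ a₀ p
            yq (sy y′q) (y′-A a₀ A-a₀) (sy (y-A a₀ A-a₀)) y≁y′ (sy (far-≁ (proj₁ A-a₀) q∈))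
            (sy yp) p~q (sy y′p) (sy (far-≁ (proj₁ A-a₀) p∈))
      ... | true | false | false | true = noC5 y p q y′ a₀
            yp p~q (sy y′q) (y′-A a₀ A-a₀) (sy (y-A a₀ A-a₀))
            yq y≁y′ (sy y′p) (sy (far-≁ (proj₁ A-a₀) p∈)) (sy (far-≁ (proj₁ A-a₀) q∈))
      ... | true | false | false | false = noP5 G free y′ a₀ y p q
            (y′-A a₀ A-a₀) (sy (y-A a₀ A-a₀)) yp p~q
            (sy y≁y′) y′p y′q (far-≁ (proj₁ A-a₀) p∈) (far-≁ (proj₁ A-a₀) q∈) yq

    -- If `a` missed `z′`, its neighbour `a′` would see `z′` by `covers`. According to whether `z`
    -- sees `a′`, the vertices `z`, `a`, `a′`, `z′`, `c₀` form a house or a C₅. Hence no vertex of A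
    -- is mixed on an anticomponent of L.
    L-twins : ∀ {z z′ a} → L z → L z′ → A a → z ≁ z′ → a ~ z → a ~ z′
    L-twins {z} {z′} {a} Lz Lz′@(Xz′ , _) (fa , a′ , fa′ , a~a′) z≁z′ a~z with bool-cases (adj G a z′)
    ... | inj₁ e = e
    ... | inj₂ n with covers Xz′ fa fa′ a~a′ (sy n) | bool-cases (adj G z a′)
    ... | z′~a′ | inj₁ z~a′ = ⊥-elim (noHouse G free z a′ z′ c₀ a
            z~a′ (sy z′~a′) (L-C Lz′ c₀∈C) (sy (L-C Lz c₀∈C)) z≁z′ (far-≁ fa′ c₀∈C)
            a~z a~a′ n (far-≁ fa c₀∈C))
    ... | z′~a′ | inj₂ z≁a′ = ⊥-elim (noC5 z a a′ z′ c₀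
            (sy a~z) a~a′ (sy z′~a′) (L-C Lz′ c₀∈C) (sy (L-C Lz c₀∈C))
            z≁a′ z≁z′ n (far-≁ fa c₀∈C) (far-≁ fa′ c₀∈C))

    -- A Helly-type induction. If `c`, complete to `bs`, misses `y`, some edge `p q` of C has only
    -- `q` adjacent to `y`, and `q` is the new witness. For if `q` missed some `y′` of `bs`, then
    -- `y` and `y′` would be adjacent by `B-twins`, and the adjacencies of `p y′`, `c q` and `c p`
    -- would leave a house, a C₅ or a P₅.
    complete-to-B : ∀ bs → All B bs → ∃ λ c → C c ≡ true × All (c ~_) bs
    complete-to-B [] [] = c₀ , c₀∈C , []
    complete-to-B (y ∷ bs) (B-y@((_ , s , s∈ , y~s) , y-A) ∷ B-bs) with complete-to-B bs B-bs
    ... | c , c∈ , c-bs with bool-cases (adj G c y)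
    ...   | inj₁ e = c , c∈ , e ∷ c-bs
    ...   | inj₂ c≁y with conn (λ v → not (adj G v y)) c s c∈ s∈ (cong not c≁y) (cong not (sy y~s))
    ...     | p , q , p∈ , q∈ , p~q , fp , fq with All.all? (q ~?_) bs
    ...       | yes q-bs = q , q∈ , not-≡ fq ∷ q-bs
    ...       | no ¬q-bs = ⊥-elim (absurd (bool-cases (adj G p y′)))
      where
      missed : ∃ λ y′ → y′ ∈ bs × ¬ q ~ y′
      missed = find (AllP.¬All⇒Any¬ (q ~?_) bs ¬q-bs)
      y′ : V G
      y′ = proj₁ missed
      q≁y′ : q ≁ y′
      q≁y′ = ¬true⇒false (proj₂ (proj₂ missed))
      B-y′ : B y′
      B-y′ = All.lookup B-bs (proj₁ (proj₂ missed))
      c~y′ : c ~ y′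
      c~y′ = All.lookup c-bs (proj₁ (proj₂ missed))
      q~y : q ~ y
      q~y = not-≡ fq
      p≁y : p ≁ y
      p≁y = not-≡ fp
      y~y′ : y ~ y′
      y~y′ with bool-cases (adj G y y′)
      ... | inj₁ e = e
      ... | inj₂ n = ⊥-elim (true≢false (trans (sym (B-twins B-y′ B-y c∈ (sy n) (sy c~y′))) (sy c≁y)))
      a₀~y : a₀ ~ y
      a₀~y = sy (y-A a₀ A-a₀)
      a₀~y′ : a₀ ~ y′
      a₀~y′ = sy (proj₂ B-y′ a₀ A-a₀)
      a₀≁ : ∀ {v} → C v ≡ true → a₀ ≁ v
      a₀≁ = far-≁ (proj₁ A-a₀)
      absurd : p ~ y′ ⊎ p ≁ y′ → ⊥
      absurd (inj₁ p~y′) = noHouse G free y′ y q p a₀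
        (sy y~y′) (sy q~y) (sy p~q) p~y′ (sy q≁y′) (sy p≁y) a₀~y′ a₀~y (a₀≁ q∈) (a₀≁ p∈)
      absurd (inj₂ p≁y′) with bool-cases (adj G c q) | bool-cases (adj G c p)
      ... | inj₁ c~q | _ = noHouse G free y′ y q c a₀
        (sy y~y′) (sy q~y) (sy c~q) c~y′ (sy q≁y′) (sy c≁y) a₀~y′ a₀~y (a₀≁ q∈) (a₀≁ c∈)
      ... | inj₂ c≁q | inj₁ c~p = noC5 c y′ y q p
        c~y′ (sy y~y′) (sy q~y) (sy p~q) (sy c~p) c≁y c≁q (sy q≁y′) (sy p≁y′) (sy p≁y)
      ... | inj₂ c≁q | inj₂ c≁p = noP5 G free c y′ y q p
        c~y′ (sy y~y′) (sy q~y) (sy p~q) c≁y c≁q c≁p (sy q≁y′) (sy p≁y′) (sy p≁y)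

    L-Clique : Set
    L-Clique = ∀ x y → L x → L y → x ≢ y → x ~ y

    -- If `a` misses `x`, its neighbour `a′` takes over: it sees `x` by `covers`, and if it missed
    -- an earlier `y`, the square `y x a′ a` would have the roof `c₀` over the edge `y x` of the
    -- clique.
    complete-to-L : L-Clique → ∀ ls → All L ls → ∃ λ a → A a × All (a ~_) ls
    complete-to-L _ [] [] = a₀ , A-a₀ , []
    complete-to-L clique (x ∷ ls) (Lx@(Xx , _) ∷ L-ls) with complete-to-L clique ls L-ls
    ... | a , Aa@(fa , a′ , fa′ , a~a′) , a-ls with bool-cases (adj G a x)
    ...   | inj₁ e = a , Aa , e ∷ a-ls
    ...   | inj₂ a≁x = a′ , (fa′ , a , fa , sy a~a′) , sy x~a′ ∷ All.tabulate a′-ls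
      where
      x~a′ : x ~ a′
      x~a′ = covers Xx fa fa′ a~a′ (sy a≁x)
      a′-ls : ∀ {y} → y ∈ ls → a′ ~ y
      a′-ls {y} y∈ with bool-cases (adj G a′ y)
      ... | inj₁ e = e
      ... | inj₂ a′≁y = ⊥-elim (noHouse G free y x a′ a c₀
              (clique y x Ly Lx (separated G (sy a~y) (sy a≁x))) x~a′ (sy a~a′) a~y (sy a′≁y) (sy a≁x)
              (sy (L-C Ly c₀∈C)) (sy (L-C Lx c₀∈C)) (sy (far-≁ fa′ c₀∈C)) (sy (far-≁ fa c₀∈C)))
        where
        Ly : L y
        Ly = All.lookup L-ls y∈
        a~y : a ~ y
        a~y = All.lookup a-ls y∈

    B? : ∀ v → Dec (B v)
    B? v = X? v ×-dec every? λ a → A? a →-dec v ~? a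

    private
      κ-of : ∀ {v} → C v ≡ true ⊎ A v ⊎ T v ⊎ B v ⊎ L v → Fin 5
      κ-of (inj₁ _) = 𝐜
      κ-of (inj₂ (inj₁ _)) = 𝐚
      κ-of (inj₂ (inj₂ (inj₁ _))) = 𝐭
      κ-of (inj₂ (inj₂ (inj₂ (inj₁ _)))) = 𝐛
      κ-of (inj₂ (inj₂ (inj₂ (inj₂ _)))) = 𝐥

      κ : V G → Fin 5
      κ v = κ-of (classify v)

      κ-A : ∀ v → κ v ≡ 𝐚 → A v
      κ-A v e with classify v
      ... | inj₂ (inj₁ Av) = Av
      κ-A v () | inj₁ _
      κ-A v () | inj₂ (inj₂ (inj₁ _))
      κ-A v () | inj₂ (inj₂ (inj₂ (inj₁ _)))
      κ-A v () | inj₂ (inj₂ (inj₂ (inj₂ _)))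

      κ-B : ∀ v → κ v ≡ 𝐛 → B v
      κ-B v e with classify v
      ... | inj₂ (inj₂ (inj₂ (inj₁ Bv))) = Bv
      κ-B v () | inj₁ _
      κ-B v () | inj₂ (inj₁ _)
      κ-B v () | inj₂ (inj₂ (inj₁ _))
      κ-B v () | inj₂ (inj₂ (inj₂ (inj₂ _)))

      κ-C : ∀ v → κ v ≡ 𝐜 → C v ≡ true
      κ-C v e with classify v
      ... | inj₁ Cv = Cv
      κ-C v () | inj₂ (inj₁ _)
      κ-C v () | inj₂ (inj₂ (inj₁ _))
      κ-C v () | inj₂ (inj₂ (inj₂ (inj₁ _)))
      κ-C v () | inj₂ (inj₂ (inj₂ (inj₂ _)))

      κ-L : ∀ v → κ v ≡ 𝐥 → L v
      κ-L v e with classify v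
      ... | inj₂ (inj₂ (inj₂ (inj₂ Lv))) = Lv
      κ-L v () | inj₁ _
      κ-L v () | inj₂ (inj₁ _)
      κ-L v () | inj₂ (inj₂ (inj₁ _))
      κ-L v () | inj₂ (inj₂ (inj₂ (inj₁ _)))

      κ-T : ∀ v → κ v ≡ 𝐭 → T v
      κ-T v e with classify v
      ... | inj₂ (inj₂ (inj₁ Tv)) = Tv
      κ-T v () | inj₁ _
      κ-T v () | inj₂ (inj₁ _)
      κ-T v () | inj₂ (inj₂ (inj₂ (inj₁ _)))
      κ-T v () | inj₂ (inj₂ (inj₂ (inj₂ _)))

      far∌C : ∀ {v} → Far C v → C v ≡ true → ⊥
      far∌C (v∉C , _) v∈C = true≢false (trans (sym v∈C) v∉C)

      far∌X : ∀ {v} → Far C v → X v → ⊥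
      far∌X (_ , far) (_ , s , s∈ , v~s) = true≢false (trans (sym v~s) (far s s∈))

      A-κ : ∀ v → A v → κ v ≡ 𝐚
      A-κ v (fv , a , fa , v~a) with classify v
      ... | inj₁ Cv = ⊥-elim (far∌C fv Cv)
      ... | inj₂ (inj₁ _) = refl
      ... | inj₂ (inj₂ (inj₁ (_ , isolated))) = ⊥-elim (true≢false (trans (sym v~a) (isolated a fa)))
      ... | inj₂ (inj₂ (inj₂ (inj₁ (Xv , _)))) = ⊥-elim (far∌X fv Xv)
      ... | inj₂ (inj₂ (inj₂ (inj₂ (Xv , _)))) = ⊥-elim (far∌X fv Xv)

      C-κ : ∀ v → C v ≡ true → κ v ≡ 𝐜
      C-κ v Cv with classify v
      ... | inj₁ _ = refl
      ... | inj₂ (inj₁ (fv , _)) = ⊥-elim (far∌C fv Cv)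
      ... | inj₂ (inj₂ (inj₁ (fv , _))) = ⊥-elim (far∌C fv Cv)
      ... | inj₂ (inj₂ (inj₂ (inj₁ ((n , _) , _)))) = ⊥-elim (true≢false (trans (sym Cv) n))
      ... | inj₂ (inj₂ (inj₂ (inj₂ ((n , _) , _)))) = ⊥-elim (true≢false (trans (sym Cv) n))

      complete-to-all : ∀ {P Q : V G → Set} → (∀ v → Dec (P v)) →
        (∀ vs → All P vs → ∃ λ u → Q u × All (u ~_) vs) → ∃ λ u → Q u × (∀ v → P v → u ~ v)
      complete-to-all P? helly =
        let u , q , all = helly (filter P? (proj₁ listing)) (AllP.all-filter P? (proj₁ listing))
        in u , q , λ v p → All.lookup all (∈P.∈-filter⁺ P? (proj₂ listing v) p)

    decomposition : L-Clique → Decomposition G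
    decomposition clique =
      let c , c∈ , c-B = complete-to-all {B} {λ v → C v ≡ true} B? complete-to-B
          a , a∈ , a-L = complete-to-all {L} {A} L? (complete-to-L clique)
          a′ , a′∈ , a≢a′ = other {A} a A-a₀ A-a₀′ a₀≢a₀′
          c′ , c′∈ , c≢c′ = other {λ v → C v ≡ true} c c₀∈C c₁∈C c₀≢c₁
      in record
      { κ = κ ; a = a ; a′ = a′ ; c = c ; c′ = c′
      ; a∈A = A-κ a a∈ ; a′∈A = A-κ a′ a′∈ ; c∈C = C-κ c c∈ ; c′∈C = C-κ c′ c′∈
      ; a≢a′ = a≢a′ ; c≢c′ = c≢c′
      ; a-L = λ v e → a-L v (κ-L v e)
      ; c-B = λ v e → c-B v (κ-B v e)
      ; L-clique = λ u v e e′ → clique u v (κ-L u e) (κ-L v e′)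
      ; T-stable = λ u v e e′ → proj₂ (κ-T u e) v (proj₁ (κ-T v e′))
      ; A-B = λ u v e e′ → sy (proj₂ (κ-B v e′) u (κ-A u e))
      ; A-T = λ u v e e′ → sy (proj₂ (κ-T v e′) u (proj₁ (κ-A u e)))
      ; A-C = λ u v e e′ → far-≁ (proj₁ (κ-A u e)) (κ-C v e′)
      ; T-C = λ u v e e′ → far-≁ (proj₁ (κ-T u e)) (κ-C v e′)
      ; L-B = λ u v e e′ → L-B (κ-L u e) (κ-B v e′)
      ; L-C = λ u v e e′ → L-C (κ-L u e) (κ-C v e′)
      ; B-twins = λ y y′ z e e′ e″ → B-twins (κ-B y e) (κ-B y′ e′) (κ-C z e″)
      }
      where
      other : ∀ {P : V G → Set} u {v w} → P v → P w → v ≢ w → ∃ λ x → P x × u ≢ x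
      other u {v} {w} pv pw v≢w with _≟_ G u v
      ... | yes refl = w , pw , v≢w
      ... | no u≢v   = v , pv , u≢v

-- If L is not a clique, grow a maximal set D in the complement H from an anticomponent Z of L.
-- Its set L is anticomplete (in G) to Z, so it lies in A ∪ T, where z ∈ Z has stable non-neighbours:
-- hence it is a clique of H.
module _ (G : Graph) (listing : Listing (V G)) (free : P5coP5Free G) (noC5 : NoC5 G) where
  open Search listing
  open Separation G listing
  open Adjacency G
  private
    H : Graph
    H = complement G
    module H = Separation H listing
    module HS = Sets H

  module _ (C : V G → Bool) (conn : Sets.Connected G C) (farEdge : FarEdge C) (maximal : Maximal C)
           (c₀ c₁ : V G) (c₀∈C : C c₀ ≡ true) (c₁∈C : C c₁ ≡ true) (c₀≢c₁ : c₀ ≢ c₁) where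
    open Split free noC5 C conn farEdge maximal c₀ c₁ c₀∈C c₁∈C c₀≢c₁

    -- Greedy growth in `H` inside L: it stops only when no remaining vertex of L has a
    -- non-neighbour in `Z`.
    anticomponent : ∀ z z′ → L z → L z′ → z ≢ z′ → z ≁ z′ →
      ∃ λ Z → (∀ v → HS.pair z z′ v ≡ true → Z v ≡ true) ×
      (HS.Connected Z × (∀ v → Z v ≡ true → L v)) × (∀ x s → L x → Z x ≡ false → Z s ≡ true → x ~ s)
    anticomponent z z′ Lz Lz′ z≢z′ z≁z′ = HS.grow listing _ _ step (HS.pair z z′)
      (HS.connected-pair z z′ (nonedge⇒co G z≢z′ z≁z′) , L-pair)
      where
      L-pair : ∀ v → HS.pair z z′ v ≡ true → L v
      L-pair v e with HS.pair-cases z z′ v e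
      ... | inj₁ refl = Lz
      ... | inj₂ refl = Lz′
      step : ∀ Z → HS.Connected Z × (∀ v → Z v ≡ true → L v) →
        (∀ x s → L x → Z x ≡ false → Z s ≡ true → x ~ s) ⊎
        ∃ λ x → Z x ≡ false × HS.Connected (HS.insert x Z) × (∀ v → HS.insert x Z v ≡ true → L v)
      step Z (conn , Z⊆L) with some? (λ x → L? x ×-dec Z x BoolP.≟ false ×-dec
                                 some? λ s → Z s BoolP.≟ true ×-dec adj G x s BoolP.≟ false)
      ... | no none = inj₁ λ x s Lx x∉ s∈ → not-≡ (¬true⇒false λ n →
              none (x , Lx , x∉ , s , s∈ , not-≡ n))
      ... | yes (x , Lx , x∉ , s , s∈ , x≁s) = inj₂ (x , x∉ ,
              HS.connected-insert Z s x conn s∈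
                (nonedge⇒co G (λ { refl → true≢false (trans (sym s∈) x∉) }) (sy x≁s)) ,
              λ v e → new v (HS.insert-cases x Z v e))
        where
        new : ∀ v → v ≡ x ⊎ Z v ≡ true → L v
        new v (inj₁ refl) = Lx
        new v (inj₂ v∈)   = Z⊆L v v∈

    co-decomposition : ∀ z z′ → L z → L z′ → z ≢ z′ → z ≁ z′ → Decomposition H
    co-decomposition z z′ Lz Lz′ z≢z′ z≁z′ with anticomponent z z′ Lz Lz′ z≢z′ z≁z′
    ... | Z , pair⊆Z , (Z-conn , Z⊆L) , Z-closed = result
      where
      z∈Z : Z z ≡ true
      z∈Z = pair⊆Z z (HS.pair-left z z′)
      z′∈Z : Z z′ ≡ true
      z′∈Z = pair⊆Z z′ (HS.pair-right z z′)
      z-edge : ∃ λ a → A a × a ~ z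
      z-edge = let Xz , a , (fa , a′ , fa′ , a~a′) , z≁a = Lz
               in a′ , (fa′ , a , fa , sy a~a′) , sy (covers Xz fa fa′ a~a′ z≁a)
      a : V G
      a = proj₁ z-edge
      Aa : A a
      Aa = proj₁ (proj₂ z-edge)
      -- By `L-twins`, adjacency to `a` propagates from `z` along the non-edges that connect `Z`.
      a-Z : ∀ s → Z s ≡ true → a ~ s
      a-Z s s∈ with bool-cases (adj G a s)
      ... | inj₁ e = e
      ... | inj₂ n with Z-conn (adj G a) z s z∈Z s∈ (proj₂ (proj₂ z-edge)) n
      ... | p , q , p∈ , q∈ , p≁q , a~p , a≁q = ⊥-elim (true≢false (trans
              (sym (L-twins (Z⊆L p p∈) (Z⊆L q q∈) Aa (proj₂ (complement-edge G p≁q)) a~p)) a≁q))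
      c-Z : ∀ s → Z s ≡ true → c₀ ~ s
      c-Z s s∈ = sy (L-C (Z⊆L s s∈) c₀∈C)
      farZ : ∀ {v} → (∀ s → Z s ≡ true → v ~ s) → H.Far Z v
      farZ {v} v-Z = ¬true⇒false (λ v∈ → edge-distinct G (v-Z v v∈) refl) , λ s s∈ → edge⇒co G (v-Z s s∈)
      a≁c₀ : a ≁ c₀
      a≁c₀ = far-≁ (proj₁ Aa) c₀∈C
      a≢c₀ : a ≢ c₀
      a≢c₀ refl = true≢false (trans (sym c₀∈C) (proj₁ (proj₁ Aa)))
      result : Decomposition H
      -- `a` and `c₀` are non-adjacent and both complete to `Z`, so in `H` they form an edge far
      -- from `Z`.
      result with H.maximal-extension Z Z-conn (a , c₀ , nonedge⇒co G a≢c₀ a≁c₀ , farZ a-Z , farZ c-Z)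
      ... | D , Z⊆D , (D-conn , D-far) , D-max = HSplit.decomposition clique
        where
        module HSplit = H.Split (complement-free G free) (complement-noC5 G noC5) D D-conn D-far D-max
                          z z′ (Z⊆D z z∈Z) (Z⊆D z′ z′∈Z) z≢z′
        -- `x` is complete in `H` to `D`, hence misses `z`. But `z` sees all of C, B and the part of
        -- L outside `Z`, and `x` is not in `Z`, so only A and T remain.
        L-far : ∀ x → HSplit.L x → x ≁ z × Far C x
        L-far x Lᴴx@((x∉D , _) , _) = x≁z , go (classify x)
          where
          x≁z : x ≁ z
          x≁z = proj₂ (complement-edge G (HSplit.L-C Lᴴx (Z⊆D z z∈Z)))
          go : C x ≡ true ⊎ A x ⊎ T x ⊎ B x ⊎ L x → Far C x
          go (inj₁ x∈C) = ⊥-elim (true≢false (trans (sym (L-C Lz x∈C)) (sy x≁z)))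
          go (inj₂ (inj₁ (fx , _))) = fx
          go (inj₂ (inj₂ (inj₁ (fx , _)))) = fx
          go (inj₂ (inj₂ (inj₂ (inj₁ Bx)))) = ⊥-elim (true≢false (trans (sym (L-B Lz Bx)) (sy x≁z)))
          go (inj₂ (inj₂ (inj₂ (inj₂ Lx)))) = ⊥-elim (true≢false (trans (sym
            (Z-closed x z Lx (¬true⇒false λ x∈ → true≢false (trans (sym (Z⊆D x x∈)) x∉D)) z∈Z)) x≁z))
        clique : HSplit.L-Clique
        clique x x′ Lx Lx′ x≢x′ with bool-cases (adj G x x′)
        ... | inj₂ n = nonedge⇒co G x≢x′ n
        -- An edge far from C with both ends missed by `z` contradicts `covers`.
        ... | inj₁ x~x′ = ⊥-elim (true≢false (trans
                (sym (covers (proj₁ Lz) (proj₂ (L-far x Lx)) (proj₂ (L-far x′ Lx′)) x~x′ (sy (proj₁ (L-far x Lx)))))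
                (sy (proj₁ (L-far x′ Lx′)))))

  decompose : ∀ u v a a′ → u ~ v → a ~ a′ → a ≁ u → a ≁ v → a′ ≁ u → a′ ≁ v →
              Decomposition G ⊎ Decomposition H
  decompose u v a a′ u~v a~a′ au av a′u a′v
    with maximal-extension (GS.pair u v) (GS.connected-pair u v u~v) (a , a′ , a~a′ , far au av , far a′u a′v)
    where
    module GS = Sets G
    far : ∀ {x} → x ≁ u → x ≁ v → Far (GS.pair u v) x
    far {x} xu xv =
      GS.pair-false u v x (λ { refl → true≢false (trans (sym u~v) xv) })
        (λ { refl → true≢false (trans (sym u~v) (sy xu)) }) , near
      where
      near : ∀ s → GS.pair u v s ≡ true → x ≁ s
      near s s∈ with GS.pair-cases u v s s∈
      ... | inj₁ refl = xu
      ... | inj₂ refl = xv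
  ... | C , ⊆ , (conn , far) , maximal = result
    where
    module GS = Sets G
    u∈ : C u ≡ true
    u∈ = ⊆ u (GS.pair-left u v)
    v∈ : C v ≡ true
    v∈ = ⊆ v (GS.pair-right u v)
    u≢v : u ≢ v
    u≢v = edge-distinct G u~v
    module S = Split free noC5 C conn far maximal u v u∈ v∈ u≢v
    result : Decomposition G ⊎ Decomposition H
    result with some? (λ z → S.L? z ×-dec some? λ z′ → S.L? z′ ×-dec ¬? (_≟_ G z z′) ×-dec adj G z z′ BoolP.≟ false)
    ... | yes (z , Lz , z′ , Lz′ , z≢z′ , z≁z′) =
          inj₂ (co-decomposition C conn far maximal u v u∈ v∈ u≢v z z′ Lz Lz′ z≢z′ z≁z′)
    ... | no none = inj₁ (S.decomposition λ x y Lx Ly x≢y → not-≡ (¬true⇒false λ n →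
            none (x , Lx , y , Ly , x≢y , not-≡ n)))

-- Split graphs

-- The adjacencies of a 2K₂ force its vertices to be distinct, whereas opposite vertices of a C₄
-- have to be separated explicitly.
No2K2 NoC4 : Graph → Set
No2K2 G = ∀ u v x y → adj G u v ≡ true → adj G x y ≡ true →
  adj G u x ≡ false → adj G u y ≡ false → adj G v x ≡ false → adj G v y ≡ false → ⊥
NoC4 G = ∀ u v x y → u ≢ x → v ≢ y →
  adj G u v ≡ true → adj G v x ≡ true → adj G x y ≡ true → adj G y u ≡ true →
  adj G u x ≡ false → adj G v y ≡ false → ⊥

-- Partial split partitions: just true marks the clique, just false the stable set, nothing the
-- vertices not yet placed.  In normal form no stable vertex is complete to the clique.
module FöldesHammer (G : Graph) (listing : Listing (V G))
                    (no2K2 : No2K2 G) (noC4 : NoC4 G) (noC5 : NoC5 G) where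
  open Search listing
  open Adjacency G

  private
    _≟ᶜ_ : (c d : Maybe Bool) → Dec (c ≡ d)
    _≟ᶜ_ = MaybeP.≡-dec BoolP._≟_

    Partition : (V G → Maybe Bool) → Set
    Partition κ = (∀ u v → κ u ≡ just true → κ v ≡ just true → u ≢ v → u ~ v) ×
                  (∀ u v → κ u ≡ just false → κ v ≡ just false → u ≁ v)

    Normal : (V G → Maybe Bool) → Set
    Normal κ = ∀ s → κ s ≡ just false → ∃ λ k → κ k ≡ just true × s ≁ k

    set : V G → Bool → (V G → Maybe Bool) → V G → Maybe Bool
    set x c κ v = if does (_≟_ G v x) then just c else κ v

    set-cases : ∀ x c κ v {d} → set x c κ v ≡ d → v ≡ x × just c ≡ d ⊎ v ≢ x × κ v ≡ d
    set-cases x c κ v e with _≟_ G v x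
    ... | yes p = inj₁ (p , e)
    ... | no ne = inj₂ (ne , e)

    set-≡ : ∀ x c κ → set x c κ x ≡ just c
    set-≡ x c κ with _≟_ G x x
    ... | yes _ = refl
    ... | no ne = ⊥-elim (ne refl)

    set-placed : ∀ x c κ v → κ v ≢ nothing → set x c κ v ≢ nothing
    set-placed x c κ v p e with set-cases x c κ v e
    ... | inj₁ (_ , ())
    ... | inj₂ (_ , e′) = p e′

    set-new : ∀ x c κ → set x c κ x ≢ nothing
    set-new x c κ e with trans (sym (set-≡ x c κ)) e
    ... | ()

    -- `x` may already be placed, so this also moves a vertex over from the stable set.
    to-clique : ∀ κ x → Partition κ → (∀ u → κ u ≡ just true → u ≢ x → x ~ u) → Partition (set x true κ)
    to-clique κ x (clique , stable) x-K = clique′ , stable′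
      where
      clique′ : ∀ u v → set x true κ u ≡ just true → set x true κ v ≡ just true → u ≢ v → u ~ v
      clique′ u v u∈ v∈ u≢v with set-cases x true κ u u∈ | set-cases x true κ v v∈
      ... | inj₁ (refl , _) | inj₁ (refl , _) = ⊥-elim (u≢v refl)
      ... | inj₁ (refl , _) | inj₂ (v≢x , v∈K) = x-K v v∈K v≢x
      ... | inj₂ (u≢x , u∈K) | inj₁ (refl , _) = sy (x-K u u∈K u≢x)
      ... | inj₂ (_ , u∈K) | inj₂ (_ , v∈K) = clique u v u∈K v∈K u≢v
      stable′ : ∀ u v → set x true κ u ≡ just false → set x true κ v ≡ just false → u ≁ v
      stable′ u v u∈ v∈ with set-cases x true κ u u∈ | set-cases x true κ v v∈
      ... | inj₂ (_ , u∈S) | inj₂ (_ , v∈S) = stable u v u∈S v∈S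

    to-stable : ∀ κ x → Partition κ → (∀ u → κ u ≡ just false → u ≢ x → x ≁ u) → Partition (set x false κ)
    to-stable κ x (clique , stable) x-S = clique′ , stable′
      where
      clique′ : ∀ u v → set x false κ u ≡ just true → set x false κ v ≡ just true → u ≢ v → u ~ v
      clique′ u v u∈ v∈ u≢v with set-cases x false κ u u∈ | set-cases x false κ v v∈
      ... | inj₂ (_ , u∈K) | inj₂ (_ , v∈K) = clique u v u∈K v∈K u≢v
      stable′ : ∀ u v → set x false κ u ≡ just false → set x false κ v ≡ just false → u ≁ v
      stable′ u v u∈ v∈ with set-cases x false κ u u∈ | set-cases x false κ v v∈
      ... | inj₁ (refl , _) | inj₁ (refl , _) = adj-irrefl G x
      ... | inj₁ (refl , _) | inj₂ (v≢x , v∈S) = x-S v v∈S v≢x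
      ... | inj₂ (u≢x , u∈S) | inj₁ (refl , _) = sy (x-S u u∈S u≢x)
      ... | inj₂ (_ , u∈S) | inj₂ (_ , v∈S) = stable u v u∈S v∈S

    Extends : (V G → Maybe Bool) → (V G → Maybe Bool) → Set
    Extends κ κ′ = ∀ u → κ u ≢ nothing → κ′ u ≢ nothing

    -- A stable vertex `s` complete to the clique is moved into it. One move suffices: afterwards
    -- every remaining stable vertex misses `s`.
    normalise : ∀ κ x → Partition κ → κ x ≡ nothing →
      ∃ λ κ′ → Partition κ′ × κ′ x ≡ nothing × Extends κ κ′ × Normal κ′
    normalise κ x part@(clique , stable) x∉
      with some? (λ s → κ s ≟ᶜ just false ×-dec every? λ k → κ k ≟ᶜ just true →-dec s ~? k)
    ... | no none = κ , part , x∉ , (λ _ p → p) , λ s s∈ →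
            let k , n = failing (λ k → κ k ≟ᶜ just true →-dec s ~? k) (λ s-K → none (s , s∈ , s-K))
            in k , miss s k n (κ k ≟ᶜ just true)
      where
      miss : ∀ s k → ¬ (κ k ≡ just true → s ~ k) → Dec (κ k ≡ just true) → κ k ≡ just true × s ≁ k
      miss s k n (yes k∈) = k∈ , ¬true⇒false (λ e → n λ _ → e)
      miss s k n (no k∉)  = ⊥-elim (n λ k∈ → ⊥-elim (k∉ k∈))
    ... | yes (s , s∈ , s-K) =
            set s true κ , to-clique κ s part (λ u u∈ _ → s-K u u∈) , still , set-placed s true κ , normal
      where
      still : set s true κ x ≡ nothing
      still with _≟_ G x s
      ... | no _ = x∉
      ... | yes refl with trans (sym s∈) x∉
      ...   | ()
      normal : Normal (set s true κ)
      normal s′ e with set-cases s true κ s′ e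
      ... | inj₂ (_ , s′∈) = s , set-≡ s true κ , stable s′ s s′∈ s∈

    module Place (κ : V G → Maybe Bool) (part : Partition κ) (normal : Normal κ)
                 (x : V G) (x∉ : κ x ≡ nothing) where
      clique : ∀ {u v} → κ u ≡ just true → κ v ≡ just true → u ≢ v → u ~ v
      clique = proj₁ part _ _
      stable : ∀ {u v} → κ u ≡ just false → κ v ≡ just false → u ≁ v
      stable = proj₂ part _ _

      differ : ∀ {u v c d} → κ u ≡ c → κ v ≡ d → c ≢ d → u ≢ v
      differ u∈ v∈ c≢d refl = c≢d (trans (sym u∈) v∈)

      -- Distinct `k` and `k′` would be adjacent and form a 2K₂ with the edge `x s`.
      common-miss : ∀ {s k k′} → x ~ s → κ k ≡ just true → κ k′ ≡ just true →
        x ≁ k → s ≁ k → x ≁ k′ → s ≁ k′ → k ≡ k′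
      common-miss {s} {k} {k′} x~s k∈ k′∈ xk sk xk′ sk′ with _≟_ G k k′
      ... | yes e = e
      ... | no ne = ⊥-elim (no2K2 x s k k′ x~s (clique k∈ k′∈ ne) xk xk′ sk sk′)

      -- `s k k′ x` would be an induced C₄.
      no-crossing : ∀ {s k k′} → κ s ≡ just false → x ~ s → κ k ≡ just true → κ k′ ≡ just true →
        s ~ k → x ≁ k → x ~ k′ → s ≁ k′ → ⊥
      no-crossing {s} {k} {k′} s∈ x~s k∈ k′∈ sk xk xk′ sk′ =
        noC4 s k k′ x (differ s∈ k′∈ λ ()) (differ k∈ x∉ λ ()) sk
          (clique k∈ k′∈ (λ { refl → true≢false (trans (sym xk′) xk) })) (sy xk′) x~s sk′ (sy xk)

      -- k joins the stable set unless it has a neighbour s′ there, and then s′k and sx form a 2K₂.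
      k-stable : ∀ {s k} → κ s ≡ just false → x ~ s → s ≁ k → x ≁ k →
        ∀ s′ → κ s′ ≡ just false → x ≁ s′ → k ≁ s′
      k-stable {s} {k} s∈ x~s sk xk s′ s′∈ xs′ =
        ¬true⇒false λ e → no2K2 k s′ s x e (sy x~s) (sy sk) (sy xk) (stable s′∈ s∈) (sy xs′)

      -- `k` and `x` trade places: `x` joins the clique and `k` the stable set. A stable neighbour
      -- of `x` misses `k`, since otherwise the clique vertex it misses by normality would give a
      -- crossing; the other stable vertices are handled by `k-stable`.
      single-miss : ∀ s k → κ s ≡ just false → x ~ s → κ k ≡ just true → x ≁ k →
        (∀ k′ → κ k′ ≡ just true → k′ ≢ k → x ~ k′) → ∃ λ κ′ → Partition κ′ × Extends κ κ′ × κ′ x ≢ nothing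
      single-miss s k s∈ x~s k∈ x≁k x-K =
        set x true κ₁ , to-clique κ₁ x (to-stable κ k part k-S) x-K′ ,
        (λ u p → set-placed x true κ₁ u (set-placed k false κ u p)) , set-new x true κ₁
        where
        κ₁ : V G → Maybe Bool
        κ₁ = set k false κ
        S-miss : ∀ s → κ s ≡ just false → x ~ s → s ≁ k
        S-miss s s∈ x~s with bool-cases (adj G s k) | normal s s∈
        ... | inj₂ n | _ = n
        ... | inj₁ sk | k′ , k′∈ , sk′ = ⊥-elim (no-crossing s∈ x~s k∈ k′∈ sk x≁k
                (x-K k′ k′∈ λ { refl → true≢false (trans (sym sk) sk′) }) sk′)
        k-S : ∀ s′ → κ s′ ≡ just false → s′ ≢ k → k ≁ s′
        k-S s′ s′∈ _ with bool-cases (adj G x s′)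
        ... | inj₁ e = sy (S-miss s′ s′∈ e)
        ... | inj₂ n = k-stable s∈ x~s (S-miss s s∈ x~s) x≁k s′ s′∈ n
        x-K′ : ∀ u → κ₁ u ≡ just true → u ≢ x → x ~ u
        x-K′ u e _ with set-cases k false κ u e
        ... | inj₂ (u≢k , u∈) = x-K u u∈ u≢k

      -- `x` turns out to have `s` as its only stable neighbour, and `s` misses just one clique
      -- vertex `k`. So `s` and `k` change sides and `x` joins the stable set.
      two-misses : ∀ s k₀ k₁ → κ s ≡ just false → x ~ s → κ k₀ ≡ just true → x ≁ k₀ →
        κ k₁ ≡ just true → x ≁ k₁ → k₁ ≢ k₀ → ∃ λ κ′ → Partition κ′ × Extends κ κ′ × κ′ x ≢ nothing
      two-misses s k₀ k₁ s∈ x~s k₀∈ xk₀ k₁∈ xk₁ k₁≢k₀ =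
        set x false κ₂ , to-stable κ₂ x (to-clique κ₁ s (to-stable κ k part k-S) s-K) x-S ,
        (λ u p → set-placed x false κ₂ u (set-placed s true κ₁ u (set-placed k false κ u p))) , set-new x false κ₂
        where
        -- If `x` saw `k`, then `s` would miss both `k₀` and `k₁` by `no-crossing`, against
        -- `common-miss`.
        missed-by-x : ∀ {s k} → κ s ≡ just false → x ~ s → κ k ≡ just true → s ≁ k → x ≁ k
        missed-by-x {s} {k} s∈ x~s k∈ sk with bool-cases (adj G x k)
        ... | inj₂ n = n
        ... | inj₁ xk = ⊥-elim (k₁≢k₀ (common-miss x~s k₁∈ k₀∈ xk₁ (miss k₁∈ xk₁) xk₀ (miss k₀∈ xk₀)))
          where
          miss : ∀ {k′} → κ k′ ≡ just true → x ≁ k′ → s ≁ k′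
          miss k′∈ xk′ = ¬true⇒false λ sk′ → no-crossing s∈ x~s k′∈ k∈ sk′ xk′ xk sk
        unique : ∀ {s k k′} → κ s ≡ just false → x ~ s → κ k ≡ just true → s ≁ k →
                 κ k′ ≡ just true → k′ ≢ k → s ~ k′
        unique {s} {k} {k′} s∈ x~s k∈ sk k′∈ k′≢k with bool-cases (adj G s k′)
        ... | inj₁ e = e
        ... | inj₂ sk′ = ⊥-elim (k′≢k (common-miss x~s k′∈ k∈
                (missed-by-x s∈ x~s k′∈ sk′) sk′ (missed-by-x s∈ x~s k∈ sk) sk))
        k : V G
        k = proj₁ (normal s s∈)
        k∈ : κ k ≡ just true
        k∈ = proj₁ (proj₂ (normal s s∈))
        sk : s ≁ k
        sk = proj₂ (proj₂ (normal s s∈))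
        xk : x ≁ k
        xk = missed-by-x s∈ x~s k∈ sk
        κ₁ κ₂ : V G → Maybe Bool
        κ₁ = set k false κ
        κ₂ = set s true κ₁
        other-miss : ∃ λ k″ → κ k″ ≡ just true × x ≁ k″ × k″ ≢ k
        other-miss with _≟_ G k₀ k
        ... | no ne    = k₀ , k₀∈ , xk₀ , ne
        ... | yes refl = k₁ , k₁∈ , xk₁ , k₁≢k₀
        -- Let a second stable neighbour `s′` of `x` miss `k′`. If `k′` is `k`, another vertex `k″`
        -- missed by `x` gives the C₄ `s k″ s′ x`; otherwise `s k′ k s′ x` is a C₅.
        only-s : ∀ s′ → κ s′ ≡ just false → x ~ s′ → s ≡ s′
        only-s s′ s′∈ x~s′ with _≟_ G s s′
        ... | yes e = e
        ... | no s≢s′ with normal s′ s′∈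
        ...   | k′ , k′∈ , s′k′ with _≟_ G k′ k | other-miss
        ...     | yes refl | k″ , k″∈ , xk″ , k″≢k = ⊥-elim (noC4 s k″ s′ x s≢s′ (differ k″∈ x∉ λ ())
                    (unique s∈ x~s k∈ sk k″∈ k″≢k) (sy (unique s′∈ x~s′ k′∈ s′k′ k″∈ k″≢k)) (sy x~s′) x~s
                    (stable s∈ s′∈) (sy xk″))
        ...     | no k′≢k | _ = ⊥-elim (noC5 s k′ k s′ x
                    (unique s∈ x~s k∈ sk k′∈ k′≢k) (clique k′∈ k∈ k′≢k)
                    (sy (unique s′∈ x~s′ k′∈ s′k′ k∈ (k′≢k ∘ sym))) (sy x~s′) x~s
                    sk (stable s∈ s′∈) (sy s′k′) (sy (missed-by-x s′∈ x~s′ k′∈ s′k′)) (sy xk))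
        k-S : ∀ s′ → κ s′ ≡ just false → s′ ≢ k → k ≁ s′
        k-S s′ s′∈ _ with bool-cases (adj G x s′)
        ... | inj₂ n = k-stable s∈ x~s sk xk s′ s′∈ n
        ... | inj₁ e with only-s s′ s′∈ e
        ...   | refl = sy sk
        s-K : ∀ u → κ₁ u ≡ just true → u ≢ s → s ~ u
        s-K u e _ with set-cases k false κ u e
        ... | inj₂ (u≢k , u∈) = unique s∈ x~s k∈ sk u∈ u≢k
        x-S : ∀ u → κ₂ u ≡ just false → u ≢ x → x ≁ u
        x-S u e _ with set-cases s true κ₁ u e
        ... | inj₂ (u≢s , e′) with set-cases k false κ u e′
        ...   | inj₁ (refl , _) = xk
        ...   | inj₂ (_ , u∈) = ¬true⇒false λ x~u → u≢s (sym (only-s u u∈ x~u))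

      place : ∃ λ κ′ → Partition κ′ × Extends κ κ′ × κ′ x ≢ nothing
      place with some? (λ k → κ k ≟ᶜ just true ×-dec adj G x k BoolP.≟ false)
      ... | no none = set x true κ ,
              to-clique κ x part (λ k k∈ _ → not-≡ (¬true⇒false λ n → none (k , k∈ , not-≡ n))) ,
              set-placed x true κ , set-new x true κ
      ... | yes (k , k∈ , xk) with some? (λ s → κ s ≟ᶜ just false ×-dec x ~? s)
      ...   | no none = set x false κ ,
                to-stable κ x part (λ s s∈ _ → ¬true⇒false λ e → none (s , s∈ , e)) ,
                set-placed x false κ , set-new x false κ
      ...   | yes (s , s∈ , xs) with some? (λ k′ → κ k′ ≟ᶜ just true ×-dec adj G x k′ BoolP.≟ false ×-dec ¬? (_≟_ G k′ k))
      ...     | no none = single-miss s k s∈ xs k∈ xk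
                  (λ k′ k′∈ k′≢k → not-≡ (¬true⇒false λ n → none (k′ , k′∈ , not-≡ n , k′≢k)))
      ...     | yes (k′ , k′∈ , xk′ , k′≢k) = two-misses s k k′ s∈ xs k∈ xk k′∈ xk′ k′≢k

    place-all : ∀ vs → ∃ λ κ → Partition κ × (∀ {v} → v ∈ vs → κ v ≢ nothing)
    place-all [] = (λ _ → nothing) , ((λ _ _ ()) , (λ _ _ ())) , λ ()
    place-all (x ∷ vs) with place-all vs
    -- The list may repeat `x`, which is then already placed.
    ... | κ , part , placed with κ x ≟ᶜ nothing
    ...   | no p = κ , part , λ { (here refl) → p ; (there v∈) → placed v∈ }
    ...   | yes x∉ with normalise κ x part x∉
    ...     | κ₁ , part₁ , x∉₁ , ext₁ , normal with Place.place κ₁ part₁ normal x x∉₁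
    ...       | κ₂ , part₂ , ext₂ , p = κ₂ , part₂ ,
                  λ { (here refl) → p ; (there v∈) → ext₂ _ (ext₁ _ (placed v∈)) }

  isSplit : IsSplit G
  isSplit with place-all (proj₁ listing)
  ... | κ , (clique , stable) , placed = side ∘ κ ,
        (λ u v u≢v u∈ v∈ → clique u v (side-true _ u∈) (side-true _ v∈) u≢v) ,
        (λ u v u∈ v∈ → stable u v (side-false _ u∈ (placed (proj₂ listing u)))
                          (side-false _ v∈ (placed (proj₂ listing v))))
    where
    side : Maybe Bool → Bool
    side (just c) = c
    -- An arbitrary default: in the end every vertex is placed.
    side nothing  = false
    side-true : ∀ c → side c ≡ true → c ≡ just true
    side-true (just _) refl = refl
    side-false : ∀ c → side c ≡ false → c ≢ nothing → c ≡ just false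
    side-false (just _) refl _ = refl
    side-false nothing _ n = ⊥-elim (n refl)

-- Finite graphs and their pieces

unique-lookup : ∀ {A : Set} {xs : List A} → Unique xs → ∀ i j → List.lookup xs i ≡ List.lookup xs j → i ≡ j
unique-lookup (x∉ ∷ u) zero zero _ = refl
unique-lookup (x∉ ∷ u) zero (suc j) e = ⊥-elim (All.lookup x∉ (∈P.∈-lookup j) e)
unique-lookup (x∉ ∷ u) (suc i) zero e = ⊥-elim (All.lookup x∉ (∈P.∈-lookup i) (sym e))
unique-lookup (x∉ ∷ u) (suc i) (suc j) e = cong suc (unique-lookup u i j e)

bijection : ∀ {A B : Set} (f : A → B) → (∀ x y → f x ≡ f y → x ≡ y) → (∀ y → ∃ λ x → f x ≡ y) → A ↔ B
bijection f inj sur = mk↔ₛ′ f (proj₁ ∘ sur) (proj₂ ∘ sur) (λ x → inj _ _ (proj₂ (sur (f x))))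

listing⇒finite : ∀ G → Listing (V G) → Finite G
listing⇒finite G (xs , all) = List.length ys ,
  ↔-sym (bijection (List.lookup ys) (unique-lookup (deduplicate-! (_≟_ G) xs))
    λ v → Any.index (ys-all v) , sym (lookup-index (ys-all v)))
  where
  ys : List (V G)
  ys = List.deduplicate (_≟_ G) xs
  ys-all : ∀ v → v ∈ ys
  ys-all v = ∈P.∈-deduplicate⁺ (_≟_ G) (all v)

finite⇒listing : ∀ G → Finite G → Listing (V G)
finite⇒listing G (n , f) = List.map from (List.allFin n) , λ v →
  subst₂ _∈_ (strictlyInverseʳ v) refl (∈P.∈-map⁺ from (∈P.∈-allFin (to v)))
  where open Inverse f

size : {V : Set} → Listing V → ℕ
size = length ∘ proj₁

module _ {V W : Set} (r : V → Maybe W) where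

  ∈-mapMaybe : ∀ {v w} vs → v ∈ vs → r v ≡ just w → w ∈ mapMaybe r vs
  ∈-mapMaybe (v ∷ vs) (here refl) e rewrite e = here refl
  ∈-mapMaybe (v ∷ vs) (there v∈) e with r v
  ... | just _  = there (∈-mapMaybe vs v∈ e)
  ... | nothing = ∈-mapMaybe vs v∈ e

  length-mapMaybe-< : ∀ {v} vs → v ∈ vs → r v ≡ nothing → length (mapMaybe r vs) < length vs
  length-mapMaybe-< (v ∷ vs) (here refl) e rewrite e = s≤s (ListP.length-mapMaybe r vs)
  length-mapMaybe-< (v ∷ vs) (there v∈) e with r v
  ... | just _  = s≤s (length-mapMaybe-< vs v∈ e)
  ... | nothing = ℕP.m<n⇒m<1+n (length-mapMaybe-< vs v∈ e)

  -- A piece is presented by a partial map from the whole graph; one vertex outside its domain makes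
  -- the transported listing strictly shorter.
  image-listing : (∀ w → ∃ λ v → r v ≡ just w) → ∀ v → r v ≡ nothing →
                  (xs : Listing V) → Σ (Listing W) λ ys → size ys < size xs
  image-listing sur v e (xs , all) =
    (mapMaybe r xs , λ w → ∈-mapMaybe xs (all _) (proj₂ (sur w))) , length-mapMaybe-< xs (all v) e

module _ (G : Graph) {W : Set} (r : W → V G) (r-inj : ∀ u v → r u ≡ r v → u ≡ v) where

  -- Induced subgraphs are taken along injections because the pieces of a unification have tagged
  -- vertex types.
  pullback : GraphOn W
  pullback = record
    { _≟_ = λ u v → map′ (r-inj u v) (cong r) (_≟_ G (r u) (r v))
    ; adj = λ u v → adj G (r u) (r v)
    ; adj-sym = λ u v → adj-sym G (r u) (r v)
    ; adj-irrefl = λ v → adj-irrefl G (r v)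
    }

  pullback-induced : ∀ Q → HasInduced (mkGraph W pullback) Q → HasInduced G Q
  pullback-induced Q (f , f-inj , f-adj) = r ∘ f , f-inj ∘ r-inj _ _ , f-adj

  pullback-free : P5coP5Free G → P5coP5Free (mkGraph W pullback)
  pullback-free (freeP5 , freeCoP5) = freeP5 ∘ pullback-induced P5 , freeCoP5 ∘ pullback-induced coP5

SmallerInClass : ∀ G → Listing (V G) → Set₁
SmallerInClass G xs = ∀ H → (ys : Listing (V H)) → size ys < size xs → P5coP5Free H → InClass H

-- Homogeneous sets and substitution

record HomogeneousSet (G : Graph) : Set where
  field
    S           : V G → Bool
    s s′ x      : V G
    s∈S         : S s ≡ true
    s′∈S        : S s′ ≡ true
    s≢s′        : s ≢ s′
    x∉S         : S x ≡ false
    homogeneous : ∀ u v w → S u ≡ false → S v ≡ true → S w ≡ true → adj G u v ≡ adj G u w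

module _ (G : Graph) (xs : Listing (V G)) (free : P5coP5Free G) (smaller : SmallerInClass G xs) where

  private
    subset-injective : ∀ (p : V G → Bool) (u v : Σ (V G) λ v → p v ≡ true) → proj₁ u ≡ proj₁ v → u ≡ v
    subset-injective p (u , e) (.u , e′) refl = cong (u ,_) (uip e e′)

    subset : (p : V G → Bool) → GraphOn (Σ (V G) λ v → p v ≡ true)
    subset p = pullback G proj₁ (subset-injective p)

    subset-in-class : ∀ (p : V G → Bool) v → p v ≡ false → InClass (mkGraph _ (subset p))
    subset-in-class p v e = let ys , lt = image-listing member member-sur v member-nothing xs
                            in smaller _ ys lt (pullback-free G proj₁ (subset-injective p) free)
      where
      member : V G → Maybe (Σ (V G) λ v → p v ≡ true)
      member v with bool-cases (p v)
      ... | inj₁ e = just (v , e)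
      ... | inj₂ _ = nothing
      member-sur : ∀ w → ∃ λ v → member v ≡ just w
      member-sur (v , e) = v , eq
        where
        eq : member v ≡ just (v , e)
        eq with bool-cases (p v)
        ... | inj₁ e′ = cong (λ e → just (v , e)) (uip e′ e)
        ... | inj₂ e′ = ⊥-elim (true≢false (trans (sym e) e′))
      member-nothing : member v ≡ nothing
      member-nothing with bool-cases (p v)
      ... | inj₁ e′ = ⊥-elim (true≢false (trans (sym e′) e))
      ... | inj₂ _ = refl

  -- Shrink `S` to its vertex `s`, then substitute the graph induced by `S` for `s`. The first graph
  -- loses `s′` and the second loses `x`, so both are smaller.
  homogeneous-in-class : HomogeneousSet G → InClass G
  homogeneous-in-class hs = iso _ G isoG
    (subst G₀ (s , s-keep) H (subset-in-class keep s′ s′-drop) (subset-in-class S x x∉S))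
    where
    open HomogeneousSet hs
    keep : V G → Bool
    keep v = if does (_≟_ G v s) then true else not (S v)
    s-keep : keep s ≡ true
    s-keep with _≟_ G s s
    ... | yes _ = refl
    ... | no ne = ⊥-elim (ne refl)
    s′-drop : keep s′ ≡ false
    s′-drop with _≟_ G s′ s
    ... | yes e = ⊥-elim (s≢s′ (sym e))
    ... | no _  = cong not s′∈S
    keep-∉ : ∀ v → v ≢ s → keep v ≡ true → S v ≡ false
    keep-∉ v ne e with _≟_ G v s
    ... | yes p = ⊥-elim (ne p)
    ... | no _  = not-≡ e
    ∉-keep : ∀ v → S v ≡ false → keep v ≡ true
    ∉-keep v e with _≟_ G v s
    ... | yes _ = refl
    ... | no _  = cong not e
    G₀ H : Graph
    G₀ = mkGraph _ (subset keep)
    H = mkGraph _ (subset S)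
    T⇒¬ : {P : Set} (d : Dec P) → Bool.T (not (does d)) → ¬ P
    T⇒¬ (no ¬p) _ = ¬p
    ¬⇒T : {P : Set} (d : Dec P) → ¬ P → Bool.T (not (does d))
    ¬⇒T (no _) _ = _
    ¬⇒T (yes p) ¬p = ¬p p
    K : Graph
    K = substitute G₀ (s , s-keep) H
    to : V K → V G
    to (inj₁ ((v , _) , _)) = v
    to (inj₂ (v , _)) = v
    outside : ∀ v → keep v ≡ true → Bool.T (not (does (_≟_ G v s))) → S v ≡ false
    outside v e p = keep-∉ v (T⇒¬ (_≟_ G v s) p) e
    to-inj : ∀ u v → to u ≡ to v → u ≡ v
    to-inj (inj₁ ((u , e) , p)) (inj₁ ((.u , e′) , p′)) refl with uip e e′
    ... | refl = cong (λ p → inj₁ ((u , e) , p)) (BoolP.T-irrelevant p p′)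
    to-inj (inj₁ ((u , e) , p)) (inj₂ (.u , u∈)) refl = ⊥-elim (true≢false (trans (sym u∈) (outside u e p)))
    to-inj (inj₂ (u , u∈)) (inj₁ ((.u , e) , p)) refl = ⊥-elim (true≢false (trans (sym u∈) (outside u e p)))
    to-inj (inj₂ (u , e)) (inj₂ (.u , e′)) refl = cong (λ e → inj₂ (u , e)) (uip e e′)
    to-sur : ∀ v → ∃ λ u → to u ≡ v
    to-sur v with bool-cases (S v)
    ... | inj₁ v∈ = inj₂ (v , v∈) , refl
    ... | inj₂ v∉ = inj₁ ((v , ∉-keep v v∉) , ¬⇒T (_≟_ G v s) (λ { refl → true≢false (trans (sym s∈S) v∉) })) , refl
    to-adj : ∀ u v → adj G (to u) (to v) ≡ adj K u v
    to-adj (inj₁ _) (inj₁ _) = refl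
    to-adj (inj₁ ((u , e) , p)) (inj₂ (v , v∈)) = homogeneous u v s (outside u e p) v∈ s∈S
    to-adj (inj₂ (v , v∈)) (inj₁ ((u , e) , p)) =
      trans (adj-sym G v u) (homogeneous u v s (outside u e p) v∈ s∈S)
    to-adj (inj₂ _) (inj₂ _) = refl
    isoG : Iso K G
    isoG = bijection to to-inj to-sur , to-adj

-- From a decomposition to a split unification

module Unify (G : Graph) (D : Decomposition G) where
  open Decomposition D
  open Adjacency G

  Class : Fin 5 → Set
  Class k = Σ (V G) λ v → κ v ≡ k

  private
    class-≡ : ∀ {k} {u v : Class k} → proj₁ u ≡ proj₁ v → u ≡ v
    class-≡ {u = u , e} {.u , e′} refl = cong (u ,_) (uip e e′)

  W₁ W₂ : Set
  W₁ = V₁ (Class 𝐚) (Class 𝐛) (Class 𝐥) (Class 𝐭)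
  W₂ = V₂ (Class 𝐛) (Class 𝐜) (Class 𝐥) (Class 𝐭)

  r₁ : W₁ → V G
  r₁ (a₁ (v , _)) = v
  r₁ (b₁ (v , _)) = v
  r₁ (l₁ (v , _)) = v
  r₁ (t₁ (v , _)) = v
  r₁ c* = c

  r₂ : W₂ → V G
  r₂ (b₂ (v , _)) = v
  r₂ (c₂ (v , _)) = v
  r₂ (l₂ (v , _)) = v
  r₂ (t₂ (v , _)) = v
  r₂ a* = a

  private
    k₁ : W₁ → Fin 5
    k₁ (a₁ _) = 𝐚
    k₁ (b₁ _) = 𝐛
    k₁ (l₁ _) = 𝐥
    k₁ (t₁ _) = 𝐭
    k₁ c* = 𝐜

    κ-r₁ : ∀ w → κ (r₁ w) ≡ k₁ w
    κ-r₁ (a₁ (_ , e)) = e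
    κ-r₁ (b₁ (_ , e)) = e
    κ-r₁ (l₁ (_ , e)) = e
    κ-r₁ (t₁ (_ , e)) = e
    κ-r₁ c* = c∈C

    k₂ : W₂ → Fin 5
    k₂ (b₂ _) = 𝐛
    k₂ (c₂ _) = 𝐜
    k₂ (l₂ _) = 𝐥
    k₂ (t₂ _) = 𝐭
    k₂ a* = 𝐚

    κ-r₂ : ∀ w → κ (r₂ w) ≡ k₂ w
    κ-r₂ (b₂ (_ , e)) = e
    κ-r₂ (c₂ (_ , e)) = e
    κ-r₂ (l₂ (_ , e)) = e
    κ-r₂ (t₂ (_ , e)) = e
    κ-r₂ a* = a∈A

  -- Equal images have equal colours, and the colour determines the constructor; this separates `c*`
  -- from the other parts.
  r₁-injective : ∀ u v → r₁ u ≡ r₁ v → u ≡ v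
  r₁-injective u v e = go u v e (trans (sym (κ-r₁ u)) (trans (cong κ e) (κ-r₁ v)))
    where
    go : ∀ u v → r₁ u ≡ r₁ v → k₁ u ≡ k₁ v → u ≡ v
    go (a₁ _) (a₁ _) e _ = cong a₁ (class-≡ e)
    go (b₁ _) (b₁ _) e _ = cong b₁ (class-≡ e)
    go (l₁ _) (l₁ _) e _ = cong l₁ (class-≡ e)
    go (t₁ _) (t₁ _) e _ = cong t₁ (class-≡ e)
    go c* c* _ _ = refl

  r₂-injective : ∀ u v → r₂ u ≡ r₂ v → u ≡ v
  r₂-injective u v e = go u v e (trans (sym (κ-r₂ u)) (trans (cong κ e) (κ-r₂ v)))
    where
    go : ∀ u v → r₂ u ≡ r₂ v → k₂ u ≡ k₂ v → u ≡ v
    go (b₂ _) (b₂ _) e _ = cong b₂ (class-≡ e)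
    go (c₂ _) (c₂ _) e _ = cong c₂ (class-≡ e)
    go (l₂ _) (l₂ _) e _ = cong l₂ (class-≡ e)
    go (t₂ _) (t₂ _) e _ = cong t₂ (class-≡ e)
    go a* a* _ _ = refl

  G₁ : GraphOn W₁
  G₁ = pullback G r₁ r₁-injective

  G₂ : GraphOn W₂
  G₂ = pullback G r₂ r₂-injective

  composable : Composable G₁ G₂
  composable = record
    { A-nonempty = a , a∈A
    ; C-nonempty = c , c∈C
    ; L-clique = λ (u , e) (v , e′) ne → L-clique u v e e′ (ne ∘ class-≡)
    ; T-stable = λ (u , e) (v , e′) → T-stable u v e e′
    ; A-complete-B = λ (u , e) (v , e′) → A-B u v e e′
    ; A-anti-T = λ (u , e) (v , e′) → A-T u v e e′
    ; A-to-L = (a , a∈A) , λ (v , e) → a-L v e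
    ; c*-complete-B = λ (v , e) → c-B v e
    ; c*-complete-L = λ (v , e) → sy (L-C v c e c∈C)
    ; c*-anti-A = λ (v , e) → sy (A-C v c e c∈C)
    ; c*-anti-T = λ (v , e) → sy (T-C v c e c∈C)
    ; same-BLT = same
    ; T-anti-C = λ (u , e) (v , e′) → T-C u v e e′
    ; L-complete-B = λ (u , e) (v , e′) → L-B u v e e′
    ; L-complete-C = λ (u , e) (v , e′) → L-C u v e e′
    ; a*-complete-B = λ (v , e) → A-B a v a∈A e
    ; a*-complete-L = λ (v , e) → a-L v e
    ; a*-anti-C = λ (v , e) → A-C a v a∈A e
    ; a*-anti-T = λ (v , e) → A-T a v a∈A e
    ; C-to-B = (c , c∈C) , λ (v , e) → c-B v e
    ; C-not-mixed = not-mixed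
    }
    where
    same : ∀ u v → GraphOn.adj G₂ (ι₂ u) (ι₂ v) ≡ GraphOn.adj G₁ (ι₁ u) (ι₁ v)
    same u v = cong₂ (adj G) (r-ι u) (r-ι v)
      where
      r-ι : ∀ u → r₂ (ι₂ u) ≡ r₁ (ι₁ u)
      r-ι (b _) = refl
      r-ι (l _) = refl
      r-ι (t _) = refl
    NonAdjacent : Class 𝐛 → Class 𝐛 → Set
    NonAdjacent (u , _) (v , _) = u ≁ v
    -- Both directions are kept because two members of an anticomponent are compared by going back
    -- to `y` along one path and forward along the other.
    along : ∀ (z : Class 𝐜) {y y′ : Class 𝐛} → Star NonAdjacent y y′ →
            (proj₁ y ~ proj₁ z → proj₁ y′ ~ proj₁ z) × (proj₁ y′ ~ proj₁ z → proj₁ y ~ proj₁ z)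
    along z ε = (λ p → p) , (λ p → p)
    along z@(w , w∈C) {y , y∈B} (_◅_ {j = y′ , y′∈B} yy′ path) with along z path
    ... | f , g = f ∘ B-twins y y′ w y∈B y′∈B w∈C yy′ , B-twins y′ y w y′∈B y∈B w∈C (sy yy′) ∘ g
    not-mixed : ∀ z y → ¬ MixedOn G₂ (c₂ z) (λ w → Σ (Class 𝐛) λ y′ → w ≡ b₂ y′ × Star NonAdjacent y y′)
    not-mixed z y (_ , _ , (y₁ , refl , p₁) , (y₂ , refl , p₂) , e , n) =
      true≢false (trans (sym (sy (proj₁ (along z p₂) (proj₂ (along z p₁) (sy e))))) n)

  U : Graph
  U = splitUnification G₁ G₂ composable

  private
    r : V U → V G
    r (aᵤ (v , _)) = v
    r (bᵤ (v , _)) = v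
    r (cᵤ (v , _)) = v
    r (lᵤ (v , _)) = v
    r (tᵤ (v , _)) = v

    k : V U → Fin 5
    k (aᵤ _) = 𝐚
    k (bᵤ _) = 𝐛
    k (cᵤ _) = 𝐜
    k (lᵤ _) = 𝐥
    k (tᵤ _) = 𝐭

    κ-r : ∀ w → κ (r w) ≡ k w
    κ-r (aᵤ (_ , e)) = e
    κ-r (bᵤ (_ , e)) = e
    κ-r (cᵤ (_ , e)) = e
    κ-r (lᵤ (_ , e)) = e
    κ-r (tᵤ (_ , e)) = e

    r-injective : ∀ u v → r u ≡ r v → u ≡ v
    r-injective u v e = go u v e (trans (sym (κ-r u)) (trans (cong κ e) (κ-r v)))
      where
      go : ∀ u v → r u ≡ r v → k u ≡ k v → u ≡ v
      go (aᵤ _) (aᵤ _) e _ = cong aᵤ (class-≡ e)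
      go (bᵤ _) (bᵤ _) e _ = cong bᵤ (class-≡ e)
      go (cᵤ _) (cᵤ _) e _ = cong cᵤ (class-≡ e)
      go (lᵤ _) (lᵤ _) e _ = cong lᵤ (class-≡ e)
      go (tᵤ _) (tᵤ _) e _ = cong tᵤ (class-≡ e)

    r-surjective : ∀ v → ∃ λ u → r u ≡ v
    r-surjective v with κ v in e
    ... | 𝐚 = aᵤ (v , e) , refl
    ... | 𝐛 = bᵤ (v , e) , refl
    ... | 𝐜 = cᵤ (v , e) , refl
    ... | 𝐥 = lᵤ (v , e) , refl
    ... | 𝐭 = tᵤ (v , e) , refl

    r-adj : ∀ u v → adj G (r u) (r v) ≡ adj U u v
    r-adj (aᵤ (u , e)) (cᵤ (v , e′)) = A-C u v e e′
    r-adj (cᵤ (v , e′)) (aᵤ (u , e)) = sy (A-C u v e e′)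
    r-adj (aᵤ _) (aᵤ _) = refl
    r-adj (aᵤ _) (bᵤ _) = refl
    r-adj (aᵤ _) (lᵤ _) = refl
    r-adj (aᵤ _) (tᵤ _) = refl
    r-adj (bᵤ _) (aᵤ _) = refl
    r-adj (bᵤ _) (bᵤ _) = refl
    r-adj (bᵤ _) (cᵤ _) = refl
    r-adj (bᵤ _) (lᵤ _) = refl
    r-adj (bᵤ _) (tᵤ _) = refl
    r-adj (cᵤ _) (bᵤ _) = refl
    r-adj (cᵤ _) (cᵤ _) = refl
    r-adj (cᵤ _) (lᵤ _) = refl
    r-adj (cᵤ _) (tᵤ _) = refl
    r-adj (lᵤ _) (aᵤ _) = refl
    r-adj (lᵤ _) (bᵤ _) = refl
    r-adj (lᵤ _) (cᵤ _) = refl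
    r-adj (lᵤ _) (lᵤ _) = refl
    r-adj (lᵤ _) (tᵤ _) = refl
    r-adj (tᵤ _) (aᵤ _) = refl
    r-adj (tᵤ _) (bᵤ _) = refl
    r-adj (tᵤ _) (cᵤ _) = refl
    r-adj (tᵤ _) (lᵤ _) = refl
    r-adj (tᵤ _) (tᵤ _) = refl

  isoU : Iso U G
  isoU = bijection r r-injective r-surjective , r-adj

  private
    -- A partial inverse of `r₁`, dropping the vertices of C other than `c`, among them `c′`. The
    -- colour is a separate argument so that it can be matched on.
    place₁ : ∀ v k → κ v ≡ k → Maybe W₁
    place₁ v 𝐚 e = just (a₁ (v , e))
    place₁ v 𝐛 e = just (b₁ (v , e))
    place₁ v 𝐥 e = just (l₁ (v , e))
    place₁ v 𝐭 e = just (t₁ (v , e))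
    place₁ v 𝐜 e = if does (_≟_ G v c) then just c* else nothing

    place₂ : ∀ v k → κ v ≡ k → Maybe W₂
    place₂ v 𝐛 e = just (b₂ (v , e))
    place₂ v 𝐜 e = just (c₂ (v , e))
    place₂ v 𝐥 e = just (l₂ (v , e))
    place₂ v 𝐭 e = just (t₂ (v , e))
    place₂ v 𝐚 e = if does (_≟_ G v a) then just a* else nothing

    place₁-r₁ : ∀ w k (e : κ (r₁ w) ≡ k) → k₁ w ≡ k → place₁ (r₁ w) k e ≡ just w
    place₁-r₁ (a₁ _) _ _ refl = cong (just ∘ a₁) (class-≡ refl)
    place₁-r₁ (b₁ _) _ _ refl = cong (just ∘ b₁) (class-≡ refl)
    place₁-r₁ (l₁ _) _ _ refl = cong (just ∘ l₁) (class-≡ refl)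
    place₁-r₁ (t₁ _) _ _ refl = cong (just ∘ t₁) (class-≡ refl)
    place₁-r₁ c* _ _ refl with _≟_ G c c
    ... | yes _ = refl
    ... | no ne = ⊥-elim (ne refl)

    place₂-r₂ : ∀ w k (e : κ (r₂ w) ≡ k) → k₂ w ≡ k → place₂ (r₂ w) k e ≡ just w
    place₂-r₂ (b₂ _) _ _ refl = cong (just ∘ b₂) (class-≡ refl)
    place₂-r₂ (c₂ _) _ _ refl = cong (just ∘ c₂) (class-≡ refl)
    place₂-r₂ (l₂ _) _ _ refl = cong (just ∘ l₂) (class-≡ refl)
    place₂-r₂ (t₂ _) _ _ refl = cong (just ∘ t₂) (class-≡ refl)
    place₂-r₂ a* _ _ refl with _≟_ G a a
    ... | yes _ = refl
    ... | no ne = ⊥-elim (ne refl)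

    place₁-c′ : ∀ k (e : κ c′ ≡ k) → k ≡ 𝐜 → place₁ c′ k e ≡ nothing
    place₁-c′ _ e refl with _≟_ G c′ c
    ... | yes p = ⊥-elim (c≢c′ (sym p))
    ... | no _  = refl

    place₂-a′ : ∀ k (e : κ a′ ≡ k) → k ≡ 𝐚 → place₂ a′ k e ≡ nothing
    place₂-a′ _ e refl with _≟_ G a′ a
    ... | yes p = ⊥-elim (a≢a′ (sym p))
    ... | no _  = refl

  listing₁ : (xs : Listing (V G)) → Σ (Listing W₁) λ ys → size ys < size xs
  listing₁ = image-listing (λ v → place₁ v (κ v) refl)
    (λ w → r₁ w , place₁-r₁ w (κ (r₁ w)) refl (sym (κ-r₁ w))) c′ (place₁-c′ (κ c′) refl c′∈C)

  listing₂ : (xs : Listing (V G)) → Σ (Listing W₂) λ ys → size ys < size xs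
  listing₂ = image-listing (λ v → place₂ v (κ v) refl)
    (λ w → r₂ w , place₂-r₂ w (κ (r₂ w)) refl (sym (κ-r₂ w))) a′ (place₂-a′ (κ a′) refl a′∈A)

decomposition-in-class : ∀ G → (xs : Listing (V G)) → P5coP5Free G → SmallerInClass G xs →
                         Decomposition G → InClass G
decomposition-in-class G xs free smaller D = iso U G isoU (unif G₁ G₂ composable
    (smaller _ (proj₁ (listing₁ xs)) (proj₂ (listing₁ xs)) (pullback-free G r₁ r₁-injective free))
    (smaller _ (proj₁ (listing₂ xs)) (proj₂ (listing₂ xs)) (pullback-free G r₂ r₂-injective free)))
  where open Unify G D

co-decomposition-in-class : ∀ G → (xs : Listing (V G)) → P5coP5Free G → SmallerInClass G xs →
                            Decomposition (complement G) → InClass G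
co-decomposition-in-class G xs free smaller D = counif G₁ G₂ composable
    (smaller _ (proj₁ (listing₁ xs)) (proj₂ (listing₁ xs))
      (complement-free (mkGraph _ G₁) (pullback-free H r₁ r₁-injective (complement-free G free))))
    (smaller _ (proj₁ (listing₂ xs)) (proj₂ (listing₂ xs))
      (complement-free (mkGraph _ G₂) (pullback-free H r₂ r₂-injective (complement-free G free))))
    G (iso-sym U H isoU)
  where
  H : Graph
  H = complement G
  open Unify H D

-- Graphs containing a pentagon

record Pentagon (G : Graph) (v₀ v₁ v₂ v₃ v₄ : V G) : Set where
  constructor pentagon-on
  open Adjacency G
  field
    e₀₁ : v₀ ~ v₁
    e₁₂ : v₁ ~ v₂
    e₂₃ : v₂ ~ v₃
    e₃₄ : v₃ ~ v₄
    e₄₀ : v₄ ~ v₀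
    n₀₂ : v₀ ≁ v₂
    n₀₃ : v₀ ≁ v₃
    n₁₃ : v₁ ≁ v₃
    n₁₄ : v₁ ≁ v₄
    n₂₄ : v₂ ≁ v₄

-- Every vertex is complete or anticomplete to a pentagon or has the two neighbours of one of its
-- vertices ("twin"); the non-uniform vertices, or else the twins of one vertex, are homogeneous.
module Fouquet (G : Graph) (listing : Listing (V G)) (free : P5coP5Free G) where
  open Search listing
  open Adjacency G

  private
    rotate : ∀ {v₀ v₁ v₂ v₃ v₄} → Pentagon G v₀ v₁ v₂ v₃ v₄ → Pentagon G v₁ v₂ v₃ v₄ v₀
    rotate P = pentagon-on e₁₂ e₂₃ e₃₄ e₄₀ e₀₁ n₁₃ n₁₄ n₂₄ (sy n₀₂) (sy n₀₃)
      where open Pentagon P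

    reflect : ∀ {v₀ v₁ v₂ v₃ v₄} → Pentagon G v₀ v₁ v₂ v₃ v₄ → Pentagon G v₀ v₄ v₃ v₂ v₁
    reflect P = pentagon-on (sy e₄₀) (sy e₃₄) (sy e₂₃) (sy e₁₂) (sy e₀₁) n₀₃ n₀₂ (sy n₂₄) (sy n₁₄) (sy n₁₃)
      where open Pentagon P

    -- Otherwise `x v₀ v₁ v₂ v₃` is a P₅.
    neighbour-next : ∀ {v₀ v₁ v₂ v₃ v₄ x} → Pentagon G v₀ v₁ v₂ v₃ v₄ →
                     x ~ v₀ → x ≁ v₂ → x ≁ v₃ → x ~ v₁
    neighbour-next {v₀} {v₁} {v₂} {v₃} {x = x} P x~v₀ xv₂ xv₃ with bool-cases (adj G x v₁)
    ... | inj₁ e = e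
    ... | inj₂ n = ⊥-elim (noP5 G free x v₀ v₁ v₂ v₃ x~v₀ e₀₁ e₁₂ e₂₃ n xv₂ xv₃ n₀₂ n₀₃ n₁₃)
      where open Pentagon P

    -- Otherwise the square `v₁ x v₄ v₀` has the roof `v₂` over `v₁ x`.
    non-neighbour-far : ∀ {v₀ v₁ v₂ v₃ v₄ x} → Pentagon G v₀ v₁ v₂ v₃ v₄ →
                        x ≁ v₀ → x ~ v₁ → x ~ v₄ → x ≁ v₂
    non-neighbour-far {v₀} {v₁} {v₂} {_} {v₄} {x} P xv₀ x~v₁ x~v₄ = ¬true⇒false λ x~v₂ →
      noHouse G free v₁ x v₄ v₀ v₂ (sy x~v₁) x~v₄ e₄₀ e₀₁ n₁₄ xv₀ (sy e₁₂) (sy x~v₂) n₂₄ (sy n₀₂)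
      where open Pentagon P

    -- Adjacency to `v₀` is left open, so that `v₀` counts as a twin of itself.
    Twin : (v₁ v₂ v₃ v₄ x : V G) → Set
    Twin v₁ v₂ v₃ v₄ x = x ~ v₁ × x ≁ v₂ × x ≁ v₃ × x ~ v₄

    twin? : ∀ v₁ v₂ v₃ v₄ x → Dec (Twin v₁ v₂ v₃ v₄ x)
    twin? v₁ v₂ v₃ v₄ x =
      x ~? v₁ ×-dec adj G x v₂ BoolP.≟ false ×-dec adj G x v₃ BoolP.≟ false ×-dec x ~? v₄

    twin-pentagon : ∀ {v₀ v₁ v₂ v₃ v₄ x} → Pentagon G v₀ v₁ v₂ v₃ v₄ → Twin v₁ v₂ v₃ v₄ x →
                    Pentagon G x v₁ v₂ v₃ v₄
    twin-pentagon P (xv₁ , xv₂ , xv₃ , xv₄) = pentagon-on xv₁ e₁₂ e₂₃ e₃₄ (sy xv₄) xv₂ xv₃ n₁₃ n₁₄ n₂₄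
      where open Pentagon P

    -- If `x` sees `v₄`, `non-neighbour-far` on both sides makes it a twin of `v₀`. If it misses
    -- `v₄`, it must see `v₃`, as `neighbour-next` would otherwise force `v₀`; it is then a twin of
    -- `v₂`.
    classify-at : ∀ {v₀ v₁ v₂ v₃ v₄ x} → Pentagon G v₀ v₁ v₂ v₃ v₄ → x ≁ v₀ → x ~ v₁ →
                  Twin v₁ v₂ v₃ v₄ x ⊎ Twin v₃ v₄ v₀ v₁ x
    classify-at {v₀} {v₁} {v₂} {v₃} {v₄} {x} P xv₀ x~v₁ with bool-cases (adj G x v₄) | bool-cases (adj G x v₃)
    ... | inj₁ xv₄ | _ = inj₁ (x~v₁ , non-neighbour-far P xv₀ x~v₁ xv₄ , non-neighbour-far (reflect P) xv₀ xv₄ x~v₁ , xv₄)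
    ... | inj₂ xv₄ | inj₁ xv₃ = inj₂ (xv₃ , xv₄ , xv₀ , x~v₁)
    ... | inj₂ xv₄ | inj₂ xv₃ = ⊥-elim (true≢false (trans
            (sym (neighbour-next (reflect (rotate P)) x~v₁ xv₄ xv₃)) xv₀))

    -- Let `x` replace `v₀` in the pentagon: a vertex constant on the other four and different at
    -- `x` is excluded by `non-neighbour-far` or `neighbour-next`.
    uniform-twin : ∀ {v₀ v₁ v₂ v₃ v₄ u x} e → Pentagon G v₀ v₁ v₂ v₃ v₄ → Twin v₁ v₂ v₃ v₄ x →
      adj G u v₁ ≡ e → adj G u v₂ ≡ e → adj G u v₃ ≡ e → adj G u v₄ ≡ e → adj G u x ≡ e
    uniform-twin true P tw uv₁ uv₂ uv₃ uv₄ = not-≡ (¬true⇒false λ n → true≢false (trans (sym uv₂)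
      (non-neighbour-far (twin-pentagon P tw) (not-≡ n) uv₁ uv₄)))
    uniform-twin false P tw uv₁ uv₂ uv₃ uv₄ = ¬true⇒false λ e → true≢false (trans
      (sym (neighbour-next (twin-pentagon P tw) e uv₂ uv₃)) uv₁)

    -- `y` is a twin of `v₁`. If it missed `x`, then `neighbour-next` at `v₂`, in the pentagon with
    -- `x` for `v₀`, would make it see `v₃`.
    twin-next : ∀ {v₀ v₁ v₂ v₃ v₄ x y} → Pentagon G v₀ v₁ v₂ v₃ v₄ →
      Twin v₁ v₂ v₃ v₄ x → Twin v₂ v₃ v₄ v₀ y → y ~ x
    twin-next {x = x} {y} P tw (yv₂ , yv₃ , yv₄ , _) = not-≡ (¬true⇒false λ n → true≢false (trans
      (sym (neighbour-next (rotate (rotate (twin-pentagon P tw))) yv₂ yv₄ (not-≡ n))) yv₃))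

    -- `y` is a twin of `v₂`. If it saw `x`, then `non-neighbour-far` at `v₄`, in the pentagon with
    -- `x` for `v₀`, would make it miss `v₁`.
    twin-far : ∀ {v₀ v₁ v₂ v₃ v₄ x y} → Pentagon G v₀ v₁ v₂ v₃ v₄ →
      Twin v₁ v₂ v₃ v₄ x → Twin v₃ v₄ v₀ v₁ y → y ≁ x
    twin-far P tw (yv₃ , yv₄ , _ , yv₁) = ¬true⇒false λ e → true≢false (trans (sym yv₁)
      (non-neighbour-far (rotate (rotate (rotate (rotate (twin-pentagon P tw))))) yv₄ e yv₃))

  module _ (v₀ v₁ v₂ v₃ v₄ : V G) (P : Pentagon G v₀ v₁ v₂ v₃ v₄) where
    private
      c : Fin 5 → V G
      c = lookup (v₀ ∷ v₁ ∷ v₂ ∷ v₃ ∷ v₄ ∷ [])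

      PentagonAt : Fin 5 → Set
      PentagonAt i = Pentagon G (c i) (c (next5 i)) (c (next5 (next5 i))) (c (next5 (next5 (next5 i))))
                                (c (next5 (next5 (next5 (next5 i)))))

      at : ∀ i → PentagonAt i
      at 0F = P
      at 1F = rotate P
      at 2F = rotate (rotate P)
      at 3F = rotate (rotate (rotate P))
      at 4F = rotate (rotate (rotate (rotate P)))

      TwinOf : Fin 5 → V G → Set
      TwinOf i = Twin (c (next5 i)) (c (next5 (next5 i))) (c (next5 (next5 (next5 i))))
                      (c (next5 (next5 (next5 (next5 i)))))

      twinOf? : ∀ i x → Dec (TwinOf i x)
      twinOf? i = twin? _ _ _ _

      Uniform : V G → Set
      Uniform x = ∃ λ e → ∀ i → adj G x (c i) ≡ e

      uniform? : ∀ x → Dec (Uniform x)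
      uniform? x = map′
        (λ { (inj₁ h) → true , h ; (inj₂ h) → false , h })
        (λ { (true , h) → inj₁ h ; (false , h) → inj₂ h })
        ((all? λ i → adj G x (c i) BoolP.≟ true) ⊎-dec (all? λ i → adj G x (c i) BoolP.≟ false))

      -- Round the cycle, a row that is not constant passes somewhere from non-adjacent to adjacent,
      -- and there `classify-at` applies.
      classify : ∀ x → Uniform x ⊎ ∃ λ i → TwinOf i x
      classify x with any? (λ i → adj G x (c i) BoolP.≟ false ×-dec adj G x (c (next5 i)) BoolP.≟ true)
      ... | yes (i , n , e) = inj₂ (twin i (classify-at (at i) n e))
        where
        twin : ∀ i → TwinOf i x ⊎
               Twin (c (next5 (next5 (next5 i)))) (c (next5 (next5 (next5 (next5 i))))) (c i) (c (next5 i)) x →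
               ∃ λ j → TwinOf j x
        twin i (inj₁ tw) = i , tw
        -- The second outcome is a twin of the vertex two steps further; a concrete index lets
        -- `next5` compute.
        twin 0F (inj₂ tw) = 2F , tw
        twin 1F (inj₂ tw) = 3F , tw
        twin 2F (inj₂ tw) = 4F , tw
        twin 3F (inj₂ tw) = 0F , tw
        twin 4F (inj₂ tw) = 1F , tw
      ... | no none = inj₁ (uniform (bool-cases (adj G x v₀)))
        where
        back : ∀ i → adj G x (c (next5 i)) ≡ true → adj G x (c i) ≡ true
        back i e = not-≡ (¬true⇒false λ n → none (i , not-≡ n , e))
        forth : ∀ i → adj G x (c i) ≡ false → adj G x (c (next5 i)) ≡ false
        forth i n = ¬true⇒false λ e → true≢false (trans (sym (back i e)) n)
        uniform : adj G x v₀ ≡ true ⊎ adj G x v₀ ≡ false → Uniform x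
        uniform (inj₁ e₀) = true , λ { 0F → e₀ ; 1F → e₁ ; 2F → e₂ ; 3F → e₃ ; 4F → e₄ }
          where
          e₄ : x ~ v₄
          e₄ = back 4F e₀
          e₃ : x ~ v₃
          e₃ = back 3F e₄
          e₂ : x ~ v₂
          e₂ = back 2F e₃
          e₁ : x ~ v₁
          e₁ = back 1F e₂
        uniform (inj₂ n₀) = false , λ { 0F → n₀ ; 1F → n₁ ; 2F → n₂ ; 3F → n₃ ; 4F → n₄ }
          where
          n₁ : x ≁ v₁
          n₁ = forth 0F n₀
          n₂ : x ≁ v₂
          n₂ = forth 1F n₁
          n₃ : x ≁ v₃
          n₃ = forth 2F n₂
          n₄ : x ≁ v₄
          n₄ = forth 3F n₃

      twins-adj : ∀ i j {x y} → i ≢ j → TwinOf i x → TwinOf j y → adj G y x ≡ c5adj j i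
      twins-adj 0F 0F ne _ _ = ⊥-elim (ne refl)
      twins-adj 1F 1F ne _ _ = ⊥-elim (ne refl)
      twins-adj 2F 2F ne _ _ = ⊥-elim (ne refl)
      twins-adj 3F 3F ne _ _ = ⊥-elim (ne refl)
      twins-adj 4F 4F ne _ _ = ⊥-elim (ne refl)
      twins-adj 0F 1F _ tx ty = twin-next (at 0F) tx ty
      twins-adj 1F 2F _ tx ty = twin-next (at 1F) tx ty
      twins-adj 2F 3F _ tx ty = twin-next (at 2F) tx ty
      twins-adj 3F 4F _ tx ty = twin-next (at 3F) tx ty
      twins-adj 4F 0F _ tx ty = twin-next (at 4F) tx ty
      twins-adj 1F 0F _ tx ty = sy (twin-next (at 0F) ty tx)
      twins-adj 2F 1F _ tx ty = sy (twin-next (at 1F) ty tx)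
      twins-adj 3F 2F _ tx ty = sy (twin-next (at 2F) ty tx)
      twins-adj 4F 3F _ tx ty = sy (twin-next (at 3F) ty tx)
      twins-adj 0F 4F _ tx ty = sy (twin-next (at 4F) ty tx)
      twins-adj 0F 2F _ tx ty = twin-far (at 0F) tx ty
      twins-adj 1F 3F _ tx ty = twin-far (at 1F) tx ty
      twins-adj 2F 4F _ tx ty = twin-far (at 2F) tx ty
      twins-adj 3F 0F _ tx ty = twin-far (at 3F) tx ty
      twins-adj 4F 1F _ tx ty = twin-far (at 4F) tx ty
      twins-adj 2F 0F _ tx ty = sy (twin-far (at 0F) ty tx)
      twins-adj 3F 1F _ tx ty = sy (twin-far (at 1F) ty tx)
      twins-adj 4F 2F _ tx ty = sy (twin-far (at 2F) ty tx)
      twins-adj 0F 3F _ tx ty = sy (twin-far (at 3F) ty tx)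
      twins-adj 1F 4F _ tx ty = sy (twin-far (at 4F) ty tx)

      does-yes : ∀ {P : Set} (d : Dec P) → P → does d ≡ true
      does-yes (yes _) _ = refl
      does-yes (no ¬p) p = ⊥-elim (¬p p)
      does-no : ∀ {P : Set} (d : Dec P) → ¬ P → does d ≡ false
      does-no (no _) _ = refl
      does-no (yes p) ¬p = ⊥-elim (¬p p)
      true⇒ : ∀ {P : Set} (d : Dec P) → does d ≡ true → P
      true⇒ (yes p) _ = p
      false⇒ : ∀ {P : Set} (d : Dec P) → does d ≡ false → ¬ P
      false⇒ (no ¬p) _ = ¬p

      c-adj : ∀ i j → adj G (c i) (c j) ≡ c5adj i j
      c-adj = inducedMap5 G (str C5) v₀ v₁ v₂ v₃ v₄ e₀₁ n₀₂ n₀₃ (sy e₄₀) e₁₂ n₁₃ n₁₄ e₂₃ n₂₄ e₃₄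
        where open Pentagon P

      c-injective : ∀ i j → c i ≡ c j → i ≡ j
      c-injective i j e = from-yes (twinFree? c5adj) i j λ k →
        trans (sym (c-adj i k)) (trans (cong (λ v → adj G v (c k)) e) (c-adj j k))

      c-not-uniform : ∀ i → ¬ Uniform (c i)
      c-not-uniform i (e , h) = true≢false (trans (sym (Pentagon.e₀₁ (at i)))
        (trans (h (next5 i)) (trans (sym (h (next5 (next5 i)))) (Pentagon.n₀₂ (at i)))))

      c-twin : ∀ i → TwinOf i (c i)
      c-twin i = e₀₁ , n₀₂ , n₀₃ , sy e₄₀
        where open Pentagon (at i)

      uniform-homogeneous : ∀ u → Uniform u → HomogeneousSet G
      uniform-homogeneous u unif-u = record
        { S = S ; s = v₀ ; s′ = v₁ ; x = u
        ; s∈S = in-S v₀ (c-not-uniform 0F) ; s′∈S = in-S v₁ (c-not-uniform 1F)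
        ; s≢s′ = edge-distinct G (Pentagon.e₀₁ P)
        ; x∉S = cong not (does-yes (uniform? u) unif-u)
        ; homogeneous = λ x v w x∉ v∈ w∈ →
            let unif-x = true⇒ (uniform? x) (not-≡ x∉) in trans (constant x unif-x v v∈) (sym (constant x unif-x w w∈))
        }
        where
        S : V G → Bool
        S v = not (does (uniform? v))
        in-S : ∀ v → ¬ Uniform v → S v ≡ true
        in-S v n = cong not (does-no (uniform? v) n)
        constant : ∀ x (unif-x : Uniform x) v → S v ≡ true → adj G x v ≡ proj₁ unif-x
        constant x (e , h) v v∈ with classify v
        ... | inj₁ unif-v = ⊥-elim (false⇒ (uniform? v) (not-≡ v∈) unif-v)
        ... | inj₂ (i , tw) = uniform-twin e (at i) tw (h (next5 i)) (h (next5 (next5 i)))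
          (h (next5 (next5 (next5 i)))) (h (next5 (next5 (next5 (next5 i)))))

      -- With no uniform vertex, every vertex is a twin of some `c j`, and by `twins-adj` its
      -- adjacency to the twins of another `c i` depends on the indices only.
      twins-homogeneous : ¬ (∃ Uniform) → ∀ x → (∀ j → c j ≢ x) → HomogeneousSet G
      twins-homogeneous none x x∉c with classify x
      ... | inj₁ u = ⊥-elim (none (x , u))
      ... | inj₂ (i , tw) = record
        { S = S ; s = c i ; s′ = x ; x = c (next5 i)
        ; s∈S = does-yes (twinOf? i (c i)) (c-twin i) ; s′∈S = does-yes (twinOf? i x) tw
        ; s≢s′ = x∉c i
        ; x∉S = does-no (twinOf? i _) λ { (_ , n , _) → true≢false (trans (sym (Pentagon.e₁₂ (at i))) n) }
        ; homogeneous = hom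
        }
        where
        S : V G → Bool
        S v = does (twinOf? i v)
        hom : ∀ u v w → S u ≡ false → S v ≡ true → S w ≡ true → adj G u v ≡ adj G u w
        hom u v w u∉ v∈ w∈ with classify u
        ... | inj₁ unif-u = ⊥-elim (none (u , unif-u))
        ... | inj₂ (j , tu) = trans (twins-adj i j i≢j (true⇒ (twinOf? i v) v∈) tu)
                                (sym (twins-adj i j i≢j (true⇒ (twinOf? i w) w∈) tu))
          where
          i≢j : i ≢ j
          i≢j refl = false⇒ (twinOf? i u) u∉ tu

    pentagon-or-homogeneous : Iso C5 G ⊎ HomogeneousSet G
    pentagon-or-homogeneous with some? uniform?
    ... | yes (u , unif-u) = inj₂ (uniform-homogeneous u unif-u)
    ... | no none with some? (λ x → all? λ j → ¬? (_≟_ G (c j) x))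
    ...   | yes (x , x∉c) = inj₂ (twins-homogeneous none x x∉c)
    ...   | no all-c = inj₁ (bijection c c-injective covered , c-adj)
      where
      covered : ∀ x → ∃ λ i → c i ≡ x
      covered x with any? (λ i → _≟_ G (c i) x)
      ... | yes p = p
      ... | no ¬p = ⊥-elim (all-c (x , λ j e → ¬p (j , e)))

-- Case distinction and induction

module _ (G : Graph) (listing : Listing (V G)) where
  open Search listing
  open Adjacency G

  pentagon? : Dec (∃ λ v₀ → ∃ λ v₁ → ∃ λ v₂ → ∃ λ v₃ → ∃ λ v₄ → Pentagon G v₀ v₁ v₂ v₃ v₄)
  pentagon? = some? λ v₀ → some? λ v₁ → some? λ v₂ → some? λ v₃ → some? λ v₄ → map′
    (λ (e₀₁ , e₁₂ , e₂₃ , e₃₄ , e₄₀ , n₀₂ , n₀₃ , n₁₃ , n₁₄ , n₂₄) →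
      pentagon-on e₀₁ e₁₂ e₂₃ e₃₄ e₄₀ n₀₂ n₀₃ n₁₃ n₁₄ n₂₄)
    edges
    (v₀ ~? v₁ ×-dec v₁ ~? v₂ ×-dec v₂ ~? v₃ ×-dec v₃ ~? v₄ ×-dec v₄ ~? v₀ ×-dec
     v₀ ≁? v₂ ×-dec v₀ ≁? v₃ ×-dec v₁ ≁? v₃ ×-dec v₁ ≁? v₄ ×-dec v₂ ≁? v₄)
    where
    edges : ∀ {v₀ v₁ v₂ v₃ v₄} → Pentagon G v₀ v₁ v₂ v₃ v₄ →
      v₀ ~ v₁ × v₁ ~ v₂ × v₂ ~ v₃ × v₃ ~ v₄ × v₄ ~ v₀ × v₀ ≁ v₂ × v₀ ≁ v₃ × v₁ ≁ v₃ × v₁ ≁ v₄ × v₂ ≁ v₄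
    edges P = e₀₁ , e₁₂ , e₂₃ , e₃₄ , e₄₀ , n₀₂ , n₀₃ , n₁₃ , n₁₄ , n₂₄
      where open Pentagon P

  record 2K2 : Set where
    field
      u v x y : V G
      u~v : u ~ v
      x~y : x ~ y
      u≁x : u ≁ x
      u≁y : u ≁ y
      v≁x : v ≁ x
      v≁y : v ≁ y

  2K2? : Dec 2K2
  2K2? = map′
    (λ (u , v , x , y , e , e′ , n₁ , n₂ , n₃ , n₄) → record
      { u~v = e ; x~y = e′ ; u≁x = n₁ ; u≁y = n₂ ; v≁x = n₃ ; v≁y = n₄ })
    (λ k → 2K2.u k , 2K2.v k , 2K2.x k , 2K2.y k ,
      2K2.u~v k , 2K2.x~y k , 2K2.u≁x k , 2K2.u≁y k , 2K2.v≁x k , 2K2.v≁y k)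
    (some? λ u → some? λ v → some? λ x → some? λ y →
      u ~? v ×-dec x ~? y ×-dec u ≁? x ×-dec u ≁? y ×-dec v ≁? x ×-dec v ≁? y)

  2K2-decompose : P5coP5Free G → NoC5 G → 2K2 → Decomposition G ⊎ Decomposition (complement G)
  2K2-decompose free noC5 k = decompose G listing free noC5 u v x y u~v x~y (sy u≁x) (sy v≁x) (sy u≁y) (sy v≁y)
    where open 2K2 k

free-step : ∀ G → (xs : Listing (V G)) → P5coP5Free G → SmallerInClass G xs → InClass G
free-step G xs free smaller = by-pentagon (pentagon? G xs)
  where
  H : Graph
  H = complement G
  by-2K2 : NoC5 G → Dec (2K2 G xs) → Dec (2K2 H xs) → InClass G
  by-2K2 noC5 (yes k) _ =
    [ decomposition-in-class G xs free smaller
    , co-decomposition-in-class G xs free smaller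
    ]′ (2K2-decompose G xs free noC5 k)
  -- The 2K₂ lies in `H`, so the roles are exchanged; a decomposition of the complement of `H` is
  -- carried to `G` by the identity on vertices.
  by-2K2 noC5 (no _) (yes k) =
    [ co-decomposition-in-class G xs free smaller
    , (λ D → iso (complement H) G (↔-refl , λ u v → sym (complement-involutive G u v))
        (decomposition-in-class (complement H) xs (complement-free H (complement-free G free)) smaller D))
    ]′ (2K2-decompose H xs (complement-free G free) (complement-noC5 G noC5) k)
  by-2K2 noC5 (no no2K2) (no noCo) = split G (listing⇒finite G xs) (FöldesHammer.isSplit G xs
    (λ u v x y e e′ n₁ n₂ n₃ n₄ → no2K2 (record
      { u~v = e ; x~y = e′ ; u≁x = n₁ ; u≁y = n₂ ; v≁x = n₃ ; v≁y = n₄ }))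
    -- The diagonals of a C₄ are the edges of a 2K₂ in the complement.
    (λ u v x y u≢x v≢y uv vx xy yu ux vy → noCo (record
      { u~v = nonedge⇒co G u≢x ux ; x~y = nonedge⇒co G v≢y vy
      ; u≁x = edge⇒co G uv ; u≁y = edge⇒co G (trans (adj-sym G u y) yu)
      ; v≁x = edge⇒co G (trans (adj-sym G x v) vx) ; v≁y = edge⇒co G xy }))
    noC5)
  by-pentagon : Dec (∃ λ v₀ → ∃ λ v₁ → ∃ λ v₂ → ∃ λ v₃ → ∃ λ v₄ → Pentagon G v₀ v₁ v₂ v₃ v₄) → InClass G
  by-pentagon (yes (v₀ , v₁ , v₂ , v₃ , v₄ , P)) =
    [ pentagon G
    , homogeneous-in-class G xs free smaller
    ]′ (Fouquet.pentagon-or-homogeneous G xs free v₀ v₁ v₂ v₃ v₄ P)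
  by-pentagon (no none) = by-2K2 noC5 (2K2? G xs) (2K2? H xs)
    where
    noC5 : NoC5 G
    noC5 v₀ v₁ v₂ v₃ v₄ e₀₁ e₁₂ e₂₃ e₃₄ e₄₀ n₀₂ n₀₃ n₁₃ n₁₄ n₂₄ =
      none (v₀ , v₁ , v₂ , v₃ , v₄ , pentagon-on e₀₁ e₁₂ e₂₃ e₃₄ e₄₀ n₀₂ n₀₃ n₁₃ n₁₄ n₂₄)

free⇒class : ∀ G → Listing (V G) → P5coP5Free G → InClass G
-- The explicit bound turns strong induction on the length into structural recursion.
free⇒class G xs = bounded (suc (size xs)) G xs ℕP.≤-refl
  where
  bounded : ∀ n G (xs : Listing (V G)) → size xs < n → P5coP5Free G → InClass G
  bounded (suc n) G xs (s≤s le) free =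
    free-step G xs free λ H ys lt → bounded n H ys (ℕP.<-≤-trans lt le)

theorem5p2 : (G : Graph) → Finite G → (P5coP5Free G ⇔ InClass G)
theorem5p2 G fin = mk⇔ (free⇒class G (finite⇒listing G fin)) (class⇒free G)
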